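{- We have $$1+\sum_{n\ge1}\frac{x^n}{n!}\sum_{\pi\in\mathfrak{S}_n(\underline{123})}t^{\mathrm{des}(\pi)+1}=\frac{e^{tx/2}\sqrt{t-4}}{\sqrt{t-4}\,\cosh\!\left(\frac{x}{2}\sqrt{t^2-4t}\right)-\sqrt{t}\,\sinh\!\left(\frac{x}{2}\sqrt{t^2-4t}\right)},$$ equivalently, $$\sum_{n\ge0}\frac{x^n}{n!}\sum_{\pi\in\mathfrak{S}_n(\underline{123})}t^{\mathrm{des}(\pi)}=\frac{t^{ -1}e^{tx/2}\sqrt{t-4}}{\sqrt{t-4}\,\cosh\!\left(\frac{x}{2}\sqrt{t^2-4t}\right)-\sqrt{t}\,\sinh\!\left(\frac{x}{2}\sqrt{t^2-4t}\right)}-\frac{1}{t}+1 .$$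
   Context: $\mathfrak{S}_n$ is the set of permutations of $\{1,\ldots,n\}$ in one-line notation ($\mathfrak{S}_0$ contains only the empty permutation, with $0$ descents), and $\mathrm{des}(\pi)=|\{i\in[n-1]:\pi_i>\pi_{i+1}\}|$. $\mathfrak{S}_n(\underline{123})$ is the set of $\pi\in\mathfrak{S}_n$ with no index $i$ such that $\pi_i<\pi_{i+1}<\pi_{i+2}$. The identities are between formal power series in $x$, with square roots taken in an extension of $\mathbb{Q}(t)$ and chosen so that $\sqrt{t^2-4t}=\sqrt{t}\,\sqrt{t-4}$. -}

module Defs where

open import Level using (_⊔_) renaming (suc to lsuc)
open import Data.Nat.Base as ℕ using (ℕ; zero; suc; _!; _<_; _<ᵇ_; _∸_)
open import Data.Nat.Properties using (_≟_; _<?_; _!≢0)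
open import Data.Integer.Base using (+_)
open import Data.Rational.Base as ℚ using (ℚ; 0ℚ; ½)
open import Data.Bool.Base using (if_then_else_)
open import Data.Fin.Base using (toℕ)
open import Data.List.Base
  using (List; []; _∷_; map; foldr; filter; upTo; cartesianProductWith)
open import Data.List.Relation.Unary.Any using (Any)
open import Data.List.Relation.Unary.Unique.DecPropositional _≟_ using (unique?)
open import Data.Product.Base using (_,_)
open import Relation.Binary.PropositionalEquality.Core using (_≢_)
open import Relation.Nullary using (¬_; Dec; yes; no)
open import Relation.Nullary.Decidable using (¬?)
open import Algebra.Bundles using (CommutativeRing; RawRing)
open import Algebra.Apartness.Bundles using (HeytingField; HeytingCommutativeRing)
open import Algebra.Morphism.Structures using (module RingMorphisms)
import Algebra.Definitions.RawSemiring as RawSemiringDefs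

words : List ℕ → ℕ → List (List ℕ)
words A zero    = [] ∷ []
words A (suc k) = cartesianProductWith _∷_ A (words A k)

-- One-line notation: a permutation of {1,…,n} is a word of length n over
-- {1,…,n} without repeated letters; each such word is listed exactly once.
𝔖 : ℕ → List (List ℕ)
𝔖 n = filter unique? (words (map suc (upTo n)) n)

des : List ℕ → ℕ
des []          = 0
des (_ ∷ [])    = 0
des (a ∷ b ∷ w) = (if b <ᵇ a then 1 else 0) ℕ.+ des (b ∷ w)

data Contains-123 : List ℕ → Set where
  here  : ∀ {a b c w} → a < b → b < c → Contains-123 (a ∷ b ∷ c ∷ w)
  there : ∀ {a w} → Contains-123 w → Contains-123 (a ∷ w)

contains-123? : ∀ w → Dec (Contains-123 w)
contains-123? []           = no λ ()
contains-123? (_ ∷ [])     = no λ { (there ()) }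
contains-123? (_ ∷ _ ∷ []) = no λ { (there (there ())) }
contains-123? (a ∷ b ∷ c ∷ w) with a <? b | b <? c | contains-123? (b ∷ c ∷ w)
... | yes p | yes q | _     = yes (here p q)
... | yes _ | no ¬q | yes r = yes (there r)
... | no ¬p | _     | yes r = yes (there r)
... | yes _ | no ¬q | no ¬r = no λ { (here _ q) → ¬q q ; (there r) → ¬r r }
... | no ¬p | _     | no ¬r = no λ { (here p _) → ¬p p ; (there r) → ¬r r }

𝔖-avoiding-123 : ℕ → List (List ℕ)
𝔖-avoiding-123 n = filter (λ π → ¬? (contains-123? π)) (𝔖 n)

-- An extension field of ℚ(t) together with the chosen square roots.  An
-- embedding of ℚ(t) into a field is given by an embedding ι of ℚ and an image
-- of t that is transcendental over ι(ℚ).  Fields are Heyting fields, so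
-- "nonzero" (that is, invertible) is expressed by apartness from 0#.
record Extension c ℓ₁ ℓ₂ : Set (lsuc (c ⊔ ℓ₁ ⊔ ℓ₂)) where
  field
    field′ : HeytingField c ℓ₁ ℓ₂

  open HeytingField field′ public

  commutativeRing : CommutativeRing c ℓ₁
  commutativeRing = HeytingCommutativeRing.commutativeRing heytingCommutativeRing

  open CommutativeRing commutativeRing public using (rawRing)
  open RawSemiringDefs (RawRing.rawSemiring rawRing) public using (_^_; sum)
  open RingMorphisms ℚ.+-*-rawRing rawRing using (IsRingHomomorphism)

  field
    ι                  : ℚ → Carrier
    ι-isHomomorphism   : IsRingHomomorphism ι
    t                  : Carrier

  -- The value at t of the polynomial with coefficients a₀ ∷ a₁ ∷ …
  eval-at-t : List ℚ → Carrier
  eval-at-t = foldr (λ a v → ι a + t * v) 0#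

  4# : Carrier
  4# = ι (+ 4 ℚ./ 1)

  field
    t-transcendental : ∀ p → Any (_≢ 0ℚ) p → eval-at-t p # 0#

    √t √[t-4] √[t²-4t] : Carrier
    √t-square          : √t * √t ≈ t
    √[t-4]-square      : √[t-4] * √[t-4] ≈ t - 4#
    √[t²-4t]-square    : √[t²-4t] * √[t²-4t] ≈ t * t - 4# * t
    √[t²-4t]-choice    : √[t²-4t] ≈ √t * √[t-4]

module PowerSeries {c ℓ₁ ℓ₂} (K : Extension c ℓ₁ ℓ₂) where
  open Extension K

  infix  4 _≋_
  infixl 6 _⊕_ _⊖_
  infixl 7 _⊛_

  -- The coefficient of xⁿ is the value at n.
  Series : Set c
  Series = ℕ → Carrier

  _≋_ : Series → Series → Set ℓ₁
  f ≋ g = ∀ n → f n ≈ g n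

  const : Carrier → Series
  const a zero    = a
  const a (suc _) = 0#

  𝟙 : Series
  𝟙 = const 1#

  _⊕_ _⊖_ _⊛_ : Series → Series → Series
  (f ⊕ g) n = f n + g n
  (f ⊖ g) n = f n - g n
  (f ⊛ g) n = sum {suc n} λ k → f (toℕ k) * g (n ∸ toℕ k)

  -- egf a = ∑ₙ aₙ xⁿ / n!
  egf : (ℕ → Carrier) → Series
  egf a n = ι (ℚ._/_ (+ 1) (n !) {{n !≢0}}) * a n

  -- exp a, cosh a and sinh a stand for e^{ax}, cosh(ax) and sinh(ax).
  exp cosh sinh : Carrier → Series
  exp a  = egf (a ^_)
  cosh a = const (ι ½) ⊛ (exp a ⊕ exp (- a))
  sinh a = const (ι ½) ⊛ (exp a ⊖ exp (- a))

  ∑ : {A : Set} → List A → (A → Carrier) → Carrier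
  ∑ xs f = foldr (λ x s → f x + s) 0# xs

  -- ∑_{n≥1} aₙ xⁿ / n!
  egf≥1 : (ℕ → Carrier) → Series
  egf≥1 a zero      = 0#
  egf≥1 a n@(suc _) = egf a n

  numerator denominator : Series
  numerator   = exp (t * ι ½) ⊛ const √[t-4]
  denominator = const √[t-4] ⊛ cosh (ι ½ * √[t²-4t]) ⊖ const √t ⊛ sinh (ι ½ * √[t²-4t])

module Submission where

-- Let Pₙ be the sum of t^{des π + 1} over 𝔖ₙ(123), with P₀ = 1, and let w be given by
-- w₀ = 1, w₁ = -t, wₙ₊₂ = -t (wₙ₊₁ + wₙ), so that ∑ wₙ xⁿ is the reciprocal of
-- 1 + t x + t x².  For every permutation, the sum over k of wₖ times the weight of what
-- remains after removing an increasing prefix of length k vanishes, because the weight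
-- depends on the length of the first run only through the coefficients of 1 + t x + t x².
-- Summing over permutations gives ∑ₖ (n choose k) wₖ Pₙ₋ₖ = 0 for n ≥ 1, so the
-- exponential generating functions of w and P are inverse to each other.  That of w
-- solves y″ + t y′ + t y = 0, hence is a combination of two exponentials, which is the
-- denominator divided by the numerator.

open import Defs
open import Algebra.Bundles using (CommutativeRing; CommutativeSemiring)
open import Algebra.Definitions using (Invertible)
import Algebra.Definitions.RawSemiring as RawSemiringDefs
open import Algebra.Morphism.Structures using (module RingMorphisms)
import Algebra.Properties.Ring as RingProperties
import Algebra.Properties.Semiring.Exp as SemiringExp
import Algebra.Solver.Ring as RingSolver
open import Algebra.Solver.Ring.AlmostCommutativeRing
  using (_-Raw-AlmostCommutative⟶_; fromCommutativeRing; Induced-equivalence)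
import Algebra.Solver.Ring.NaturalCoefficients.Default as SemiringSolver
open import Data.Bool.Base using (Bool; true; false; not; if_then_else_; _∧_)
open import Data.Bool.Properties using (T-≡; ¬-not)
import Data.Integer.Base as ℤ
open import Data.Integer.Base using (+_)
import Data.Integer.Properties as ℤₚ
open import Data.List.Base
  using (List; []; _∷_; _++_; map; foldr; filter; length; applyUpTo; upTo; cartesianProductWith)
open import Data.List.Properties using (length-++; length-++-sucʳ; map-upTo; length-map; length-upTo; ++-assoc)
open import Data.List.Relation.Unary.All as All using (All; []; _∷_)
import Data.List.Relation.Unary.All.Properties as Allₚ
open import Data.List.Relation.Unary.AllPairs as AllPairs using (AllPairs; []; _∷_)
import Data.List.Relation.Unary.AllPairs.Properties as AllPairsₚ
import Data.List.Relation.Unary.Any as Any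
import Data.Maybe.Base as Maybe
open import Data.Nat.Base as ℕ using (ℕ; zero; suc; _!; _<_; _≤_; _<ᵇ_; s≤s; z≤n; z<s; NonZero)
open import Data.Nat.Properties as ℕₚ
  using (_≟_; _!≢0; <⇒<ᵇ; <ᵇ⇒<; <-asym; <-irrefl; <-trans; <-cmp; ≤-refl; ≤-trans; <⇒≤; <⇒≢; ≤⇒≯; m≤m+n)
open import Data.List.Relation.Unary.Unique.DecPropositional _≟_ using (Unique; unique?)
open import Data.Product.Base using (∃-syntax; proj₁; proj₂)
open import Data.Product using (_×_; _,_; Σ-syntax)
open import Data.Rational.Base as ℚ using (ℚ; ½; 1ℚ; 0ℚ)
import Data.Rational.Properties as ℚₚ
open import Data.Rational.Unnormalised.Base as ℚᵘ using (mkℚᵘ; *≡*)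
import Data.Rational.Unnormalised.Properties as ℚᵘₚ
open import Function.Base using (_∘_; id)
open import Function.Bundles using (Equivalence; mk⇔)
open import Relation.Binary.Consequences using (dec⇒weaklyDec)
open import Relation.Binary.Definitions using (WeaklyDecidable; tri<; tri≈; tri>)
open import Relation.Binary.PropositionalEquality as ≡ using (_≡_; _≢_)
open import Relation.Nullary using (¬_; Dec; yes; no; does; contradiction)
open import Relation.Nullary.Decidable using (¬?; does-⇔; dec-true)
open import Relation.Unary using (Decidable)

-- Comparisons, sorted lists and standardisation

<⇒<ᵇ≡true : ∀ {a b} → a < b → (a <ᵇ b) ≡ true
<⇒<ᵇ≡true a<b = Equivalence.to T-≡ (<⇒<ᵇ a<b)

≮⇒<ᵇ≡false : ∀ {a b} → ¬ a < b → (a <ᵇ b) ≡ false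
≮⇒<ᵇ≡false {a} {b} a≮b = ¬-not (λ eq → a≮b (<ᵇ⇒< a b (Equivalence.from T-≡ eq)))

AllPairs-remove : ∀ {a ℓ} {A : Set a} {R : A → A → Set ℓ} xs {y ys} →
                  AllPairs R (xs ++ y ∷ ys) → AllPairs R (xs ++ ys)
AllPairs-remove []       (_ ∷ Rys)    = Rys
AllPairs-remove (x ∷ xs) (Rx ∷ Rxsys) =
  Allₚ.++⁺ (Allₚ.++⁻ˡ xs Rx) (All.tail (Allₚ.++⁻ʳ xs Rx)) ∷ AllPairs-remove xs Rxsys

AllPairs-middle : ∀ {a ℓ} {A : Set a} {R : A → A → Set ℓ} xs {y ys} →
                  AllPairs R (xs ++ y ∷ ys) → All (λ x → R x y) xs × All (R y) ys
AllPairs-middle []       (Ry ∷ _)     = [] , Ry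
AllPairs-middle (x ∷ xs) (Rx ∷ Rxsys) with AllPairs-middle xs Rxsys
... | Rxs , Rys = All.head (Allₚ.++⁻ʳ xs Rx) ∷ Rxs , Rys

OrderEmbedding : (ℕ → ℕ) → Set
OrderEmbedding g = ∀ i j → (g i <ᵇ g j) ≡ (i <ᵇ j)

-- This is standardisation: `g` carries the positions 0, 1, ... to the letters of `A`. It has to be
-- defined on all of ℕ, so past the end of the list it continues as a shift. The lower bound `b`
-- carries the induction: everything produced from the tail stays above the head.
sorted⇒image : ∀ b A → AllPairs _<_ A → All (b ≤_) A →
               ∃[ g ] OrderEmbedding g × (∀ i → b ≤ g i) × A ≡ applyUpTo g (length A)
sorted⇒image b []      _           _         =
  (b ℕ.+_) , shift b , (λ i → m≤m+n b i) , ≡.refl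
  where
  shift : ∀ b → OrderEmbedding (b ℕ.+_)
  shift zero    _ _ = ≡.refl
  shift (suc b) i j = shift b i j
sorted⇒image b (a ∷ A) (a<A ∷ A↗) (b≤a ∷ _) with sorted⇒image (suc a) A A↗ a<A
... | g , g-emb , a<g , A≡ = g′ , emb , b≤g′ , ≡.cong (a ∷_) A≡
  where
  g′ : ℕ → ℕ
  g′ zero    = a
  g′ (suc i) = g i

  emb : OrderEmbedding g′
  emb zero    zero    = ≮⇒<ᵇ≡false (<-irrefl {a} ≡.refl)
  emb zero    (suc j) = <⇒<ᵇ≡true (a<g j)
  emb (suc i) zero    = ≮⇒<ᵇ≡false (<-asym (a<g i))
  emb (suc i) (suc j) = g-emb i j

  b≤g′ : ∀ i → b ≤ g′ i
  b≤g′ zero    = b≤a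
  b≤g′ (suc i) = ≤-trans b≤a (<⇒≤ (a<g i))

-- Binomial convolution, the product of exponential generating functions

module BinomialConvolution {c ℓ} (R : CommutativeSemiring c ℓ) where
  open CommutativeSemiring R
  open RawSemiringDefs rawSemiring using (_^_)
  open SemiringSolver R using (solve; con; _:=_; _:+_; _:*_)
  open import Relation.Binary.Reasoning.Setoid setoid

  infixl 7 _⋆_

  -- (u ⋆ v) n = ∑ₖ (n choose k) uₖ vₙ₋ₖ, the recursion being Pascal's rule.
  _⋆_ : (ℕ → Carrier) → (ℕ → Carrier) → ℕ → Carrier
  (u ⋆ v) zero    = u 0 * v 0
  (u ⋆ v) (suc n) = (u ∘ suc ⋆ v) n + (u ⋆ v ∘ suc) n

  ⋆-cong : ∀ {u u′ v v′} → (∀ n → u n ≈ u′ n) → (∀ n → v n ≈ v′ n) →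
           ∀ n → (u ⋆ v) n ≈ (u′ ⋆ v′) n
  ⋆-cong u≈ v≈ zero    = *-cong (u≈ 0) (v≈ 0)
  ⋆-cong u≈ v≈ (suc n) = +-cong (⋆-cong (u≈ ∘ suc) v≈ n) (⋆-cong u≈ (v≈ ∘ suc) n)

  ⋆-comm : ∀ u v n → (u ⋆ v) n ≈ (v ⋆ u) n
  ⋆-comm u v zero    = *-comm _ _
  ⋆-comm u v (suc n) = trans (+-cong (⋆-comm _ _ n) (⋆-comm _ _ n)) (+-comm _ _)

  ⋆-distribˡ : ∀ u v w n → (u ⋆ (λ i → v i + w i)) n ≈ (u ⋆ v) n + (u ⋆ w) n
  ⋆-distribˡ u v w zero    = distribˡ _ _ _
  ⋆-distribˡ u v w (suc n) = trans (+-cong (⋆-distribˡ _ v w n) (⋆-distribˡ u _ _ n))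
    (solve 4 (λ a b c d → (a :+ b) :+ (c :+ d) := (a :+ c) :+ (b :+ d)) refl _ _ _ _)

  ⋆-distribʳ : ∀ u v w n → ((λ i → v i + w i) ⋆ u) n ≈ (v ⋆ u) n + (w ⋆ u) n
  ⋆-distribʳ u v w n = begin
    ((λ i → v i + w i) ⋆ u) n  ≈⟨ ⋆-comm _ _ n ⟩
    (u ⋆ (λ i → v i + w i)) n  ≈⟨ ⋆-distribˡ u v w n ⟩
    (u ⋆ v) n + (u ⋆ w) n      ≈⟨ +-cong (⋆-comm u v n) (⋆-comm u w n) ⟩
    (v ⋆ u) n + (w ⋆ u) n      ∎

  -- By its recursion `_⋆_` has the shift `_∘ suc` as a derivation, so both bracketings expand into
  -- the same three summands, one for each shifted factor.
  ⋆-assoc : ∀ u v w n → (u ⋆ v ⋆ w) n ≈ (u ⋆ (v ⋆ w)) n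
  ⋆-assoc u v w zero    = *-assoc _ _ _
  ⋆-assoc u v w (suc n) = begin
    ((u ⋆ v) ∘ suc ⋆ w) n + (u ⋆ v ⋆ w ∘ suc) n
      ≈⟨ +-cong (⋆-distribʳ w _ _ n) (⋆-assoc u v _ n) ⟩
    (u ∘ suc ⋆ v ⋆ w) n + (u ⋆ v ∘ suc ⋆ w) n + (u ⋆ (v ⋆ w ∘ suc)) n
      ≈⟨ +-congʳ (+-cong (⋆-assoc _ v w n) (⋆-assoc u _ w n)) ⟩
    (u ∘ suc ⋆ (v ⋆ w)) n + (u ⋆ (v ∘ suc ⋆ w)) n + (u ⋆ (v ⋆ w ∘ suc)) n
      ≈⟨ +-assoc _ _ _ ⟩
    (u ∘ suc ⋆ (v ⋆ w)) n + ((u ⋆ (v ∘ suc ⋆ w)) n + (u ⋆ (v ⋆ w ∘ suc)) n)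
      ≈⟨ +-congˡ (⋆-distribˡ u _ _ n) ⟨
    (u ∘ suc ⋆ (v ⋆ w)) n + (u ⋆ (v ⋆ w) ∘ suc) n ∎

  ⋆-scaleˡ : ∀ a u v n → ((λ i → a * u i) ⋆ v) n ≈ a * (u ⋆ v) n
  ⋆-scaleˡ a u v zero    = *-assoc _ _ _
  ⋆-scaleˡ a u v (suc n) = trans (+-cong (⋆-scaleˡ a _ v n) (⋆-scaleˡ a u _ n)) (sym (distribˡ _ _ _))

  ⋆-scaleʳ : ∀ a u v n → (u ⋆ (λ i → a * v i)) n ≈ a * (u ⋆ v) n
  ⋆-scaleʳ a u v n = begin
    (u ⋆ (λ i → a * v i)) n  ≈⟨ ⋆-comm _ _ n ⟩
    ((λ i → a * v i) ⋆ u) n  ≈⟨ ⋆-scaleˡ a v u n ⟩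
    a * (v ⋆ u) n            ≈⟨ *-congˡ (⋆-comm v u n) ⟩
    a * (u ⋆ v) n            ∎

  -- This is e^{ax} e^{bx} = e^{(a+b)x}: the shift multiplies `a ^_` by `a` and `b ^_` by `b`, hence
  -- their product by `a + b`.
  ⋆-power : ∀ a b n → ((a ^_) ⋆ (b ^_)) n ≈ (a + b) ^ n
  ⋆-power a b zero    = *-identityˡ _
  ⋆-power a b (suc n) = begin
    ((a ^_) ∘ suc ⋆ (b ^_)) n + ((a ^_) ⋆ (b ^_) ∘ suc) n
      ≈⟨ +-cong (⋆-scaleˡ a _ _ n) (⋆-scaleʳ b _ _ n) ⟩
    a * ((a ^_) ⋆ (b ^_)) n + b * ((a ^_) ⋆ (b ^_)) n
      ≈⟨ distribʳ _ _ _ ⟨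
    (a + b) * ((a ^_) ⋆ (b ^_)) n
      ≈⟨ *-congˡ (⋆-power a b n) ⟩
    (a + b) * (a + b) ^ n ∎

  ⋆-zeroʳ : ∀ {z} → (∀ n → z n ≈ 0#) → ∀ u n → (u ⋆ z) n ≈ 0#
  ⋆-zeroʳ z≈0 u zero    = trans (*-congˡ (z≈0 0)) (zeroʳ _)
  ⋆-zeroʳ z≈0 u (suc n) =
    trans (+-cong (⋆-zeroʳ z≈0 _ n) (⋆-zeroʳ (z≈0 ∘ suc) u n)) (+-identityˡ 0#)

  -- 0# ^_ is the sequence 1, 0, 0, …
  ⋆-identityʳ : ∀ u n → (u ⋆ (0# ^_)) n ≈ u n
  ⋆-identityʳ u zero    = *-identityʳ _
  ⋆-identityʳ u (suc n) =
    trans (+-cong (⋆-identityʳ _ n) (⋆-zeroʳ (λ k → zeroˡ (0# ^ k)) u n)) (+-identityʳ _)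

-- Finite sums over lists and words

module RunTheorem {c ℓ} (R : CommutativeSemiring c ℓ) (t : CommutativeSemiring.Carrier R) where
  open CommutativeSemiring R
  open RawSemiringDefs rawSemiring using (_^_)
  open BinomialConvolution R
  open SemiringSolver R using (solve; con; _:=_; _:+_; _:*_)
  open import Relation.Binary.Reasoning.Setoid setoid

  infix 0 _when_
  _when_ : Carrier → Bool → Carrier
  x when b = if b then x else 0#

  when-cong : ∀ {p} {P : Set p} (P? : Dec P) {x y} → (P → x ≈ y) → (x when does P?) ≈ (y when does P?)
  when-cong (yes p) x≈y = x≈y p
  when-cong (no _)  _   = refl

  when-∧ : ∀ x b b′ → (x when b ∧ b′) ≡ ((x when b′) when b)
  when-∧ x true  b′ = ≡.refl
  when-∧ x false b′ = ≡.refl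

  ∑ : {A : Set} → List A → (A → Carrier) → Carrier
  ∑ xs f = foldr (λ x s → f x + s) 0# xs

  ∑-cong : ∀ {A : Set} {xs : List A} {f g} → All (λ x → f x ≈ g x) xs → ∑ xs f ≈ ∑ xs g
  ∑-cong []         = refl
  ∑-cong (eq ∷ eqs) = +-cong eq (∑-cong eqs)

  ∑-cong′ : ∀ {A : Set} (xs : List A) {f g} → (∀ x → f x ≈ g x) → ∑ xs f ≈ ∑ xs g
  ∑-cong′ xs eq = ∑-cong (All.universal eq xs)

  ∑-0 : ∀ {A : Set} (xs : List A) → ∑ xs (λ _ → 0#) ≈ 0#
  ∑-0 []       = refl
  ∑-0 (x ∷ xs) = trans (+-identityˡ _) (∑-0 xs)

  ∑-++ : ∀ {A : Set} (xs ys : List A) f → ∑ (xs ++ ys) f ≈ ∑ xs f + ∑ ys f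
  ∑-++ []       ys f = sym (+-identityˡ _)
  ∑-++ (x ∷ xs) ys f = trans (+-congˡ (∑-++ xs ys f)) (sym (+-assoc _ _ _))

  ∑-map : ∀ {A B : Set} (g : A → B) xs f → ∑ (map g xs) f ≡ ∑ xs (f ∘ g)
  ∑-map g []       f = ≡.refl
  ∑-map g (x ∷ xs) f = ≡.cong (_+_ (f (g x))) (∑-map g xs f)

  ∑-filter : ∀ {A : Set} {P : A → Set} (P? : Decidable P) xs f →
             ∑ (filter P? xs) f ≈ ∑ xs (λ x → f x when does (P? x))
  ∑-filter P? []       f = refl
  ∑-filter P? (x ∷ xs) f with does (P? x)
  ... | true  = +-congˡ (∑-filter P? xs f)
  ... | false = trans (∑-filter P? xs f) (sym (+-identityˡ _))

  ∑-words : ∀ A k f → ∑ (words A (suc k)) f ≈ ∑ A (λ a → ∑ (words A k) (f ∘ (a ∷_)))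
  ∑-words A k f = go A
    where
    go : ∀ B → ∑ (cartesianProductWith _∷_ B (words A k)) f ≈ ∑ B (λ a → ∑ (words A k) (f ∘ (a ∷_)))
    go []      = refl
    go (b ∷ B) = trans (∑-++ (map (b ∷_) (words A k)) _ f)
                       (+-cong (reflexive (∑-map (b ∷_) (words A k) f)) (go B))

  -- Sums over arrangements, with letters chosen without replacement

  ∑-pick : List ℕ → (ℕ → List ℕ → Carrier) → Carrier
  ∑-pick []      h = 0#
  ∑-pick (a ∷ A) h = h a A + ∑-pick A (λ b B → h b (a ∷ B))

  -- Removing each chosen letter takes the place of a test for repetitions. Since `∑-pick` leaves
  -- the other letters in their order, a sorted `A` stays sorted throughout.
  ∑-arr : ℕ → List ℕ → (List ℕ → Carrier) → Carrier
  ∑-arr zero    A f = f []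
  ∑-arr (suc k) A f = ∑-pick A (λ a B → ∑-arr k B (f ∘ (a ∷_)))

  ∑-pick-cong : ∀ {A h h′} → All (λ a → ∀ B → h a B ≈ h′ a B) A → ∑-pick A h ≈ ∑-pick A h′
  ∑-pick-cong []         = refl
  ∑-pick-cong (eq ∷ eqs) = +-cong (eq _) (∑-pick-cong (All.map (λ eq B → eq _) eqs))

  ∑-pick-cong′ : ∀ A {h h′} → (∀ a B → h a B ≈ h′ a B) → ∑-pick A h ≈ ∑-pick A h′
  ∑-pick-cong′ A eq = ∑-pick-cong (All.universal eq A)

  ∑-pick-+ : ∀ A h h′ → ∑-pick A (λ a B → h a B + h′ a B) ≈ ∑-pick A h + ∑-pick A h′
  ∑-pick-+ []      h h′ = sym (+-identityˡ _)
  ∑-pick-+ (a ∷ A) h h′ = trans (+-congˡ (∑-pick-+ A _ _))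
    (solve 4 (λ a b c d → (a :+ b) :+ (c :+ d) := (a :+ c) :+ (b :+ d)) refl _ _ _ _)

  ∑-pick-* : ∀ x A h → ∑-pick A (λ a B → x * h a B) ≈ x * ∑-pick A h
  ∑-pick-* x []      h = sym (zeroʳ x)
  ∑-pick-* x (a ∷ A) h = trans (+-congˡ (∑-pick-* x A _)) (sym (distribˡ _ _ _))

  ∑-pick-map : ∀ g A h → ∑-pick (map g A) h ≡ ∑-pick A (λ a B → h (g a) (map g B))
  ∑-pick-map g []      h = ≡.refl
  ∑-pick-map g (a ∷ A) h = ≡.cong (_+_ (h (g a) (map g A))) (∑-pick-map g A _)

  -- Serves to change the threshold in `peel`, which affects only the words that start with `x`. The
  -- hypotheses range over every remainder `B` because the induction on `D` puts the skipped letters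
  -- back in front of it.
  ∑-pick-perturb : ∀ D {x L h h′} (e : List ℕ → Carrier) →
                   All (λ a → ∀ B → h a B ≈ h′ a B) D → All (λ a → ∀ B → h a B ≈ h′ a B) L →
                   (∀ B → h x B ≈ h′ x B + e B) →
                   ∑-pick (D ++ x ∷ L) h ≈ ∑-pick (D ++ x ∷ L) h′ + e (D ++ L)
  ∑-pick-perturb []      e []         eqL eqx = trans
    (+-cong (eqx _) (∑-pick-cong (All.map (λ eq B → eq _) eqL)))
    (solve 3 (λ a b c → (a :+ b) :+ c := (a :+ c) :+ b) refl _ _ _)
  ∑-pick-perturb (d ∷ D) e (eq ∷ eqD) eqL eqx = trans
    (+-cong (eq _) (∑-pick-perturb D _ (All.map (λ eq B → eq _) eqD) (All.map (λ eq B → eq _) eqL) (λ B → eqx _)))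
    (sym (+-assoc _ _ _))

  ∑-arr-cong : ∀ k A {f f′} → (∀ w → f w ≈ f′ w) → ∑-arr k A f ≈ ∑-arr k A f′
  ∑-arr-cong zero    A eq = eq []
  ∑-arr-cong (suc k) A eq = ∑-pick-cong′ A (λ a B → ∑-arr-cong k B (eq ∘ (a ∷_)))

  ∑-arr-+ : ∀ k A f f′ → ∑-arr k A (λ w → f w + f′ w) ≈ ∑-arr k A f + ∑-arr k A f′
  ∑-arr-+ zero    A f f′ = refl
  ∑-arr-+ (suc k) A f f′ = trans (∑-pick-cong′ A (λ a B → ∑-arr-+ k B _ _)) (∑-pick-+ A _ _)

  ∑-arr-* : ∀ x k A f → ∑-arr k A (λ w → x * f w) ≈ x * ∑-arr k A f
  ∑-arr-* x zero    A f = refl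
  ∑-arr-* x (suc k) A f = trans (∑-pick-cong′ A (λ a B → ∑-arr-* x k B _)) (∑-pick-* x A _)

  ∑-arr-map : ∀ g k A f → ∑-arr k (map g A) f ≈ ∑-arr k A (f ∘ map g)
  ∑-arr-map g zero    A f = refl
  ∑-arr-map g (suc k) A f = trans (reflexive (∑-pick-map g A _))
    (∑-pick-cong′ A (λ a B → ∑-arr-map g k B _))

  ∑-as-∑-pick : ∀ A f h → (∀ D {a L} → A ≡ D ++ a ∷ L → f a ≈ h a (D ++ L)) → ∑ A f ≈ ∑-pick A h
  ∑-as-∑-pick []      f h eq = refl
  ∑-as-∑-pick (a ∷ A) f h eq =
    +-cong (eq [] ≡.refl) (∑-as-∑-pick A f _ (λ D A≡ → eq (a ∷ D) (≡.cong (a ∷_) A≡)))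

  -- Words without repeated letters as arrangements

  avoids? : ∀ a → Decidable (All (a ≢_))
  avoids? a = All.all? (λ b → ¬? (a ≟ b))

  ∑-drop-letter : ∀ D {a L} f → Unique (D ++ a ∷ L) →
                  ∑ (D ++ a ∷ L) (λ b → f b when does (¬? (a ≟ b))) ≈ ∑ (D ++ L) f
  ∑-drop-letter [] {a} {L} f (a∉L ∷ _) rewrite dec-true (a ≟ a) ≡.refl =
    trans (+-identityˡ _) (∑-cong (All.map (λ {b} a≢b →
      reflexive (≡.cong (f b when_) (dec-true (¬? (a ≟ b)) a≢b))) a∉L))
  ∑-drop-letter (d ∷ D) {a} {L} f (d∉ ∷ DaL!)
    rewrite dec-true (¬? (a ≟ d)) (λ a≡d → All.head (Allₚ.++⁻ʳ D d∉) (≡.sym a≡d)) =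
    +-congˡ (∑-drop-letter D f DaL!)

  -- Distinctness of the alphabet ensures that deleting the single occurrence of `a` forbids this
  -- letter altogether.
  ∑-words-avoiding : ∀ k D {a L} f → Unique (D ++ a ∷ L) →
                     ∑ (words (D ++ a ∷ L) k) (λ w → f w when does (avoids? a w)) ≈ ∑ (words (D ++ L) k) f
  ∑-words-avoiding zero    D f A! = refl
  ∑-words-avoiding (suc k) D {a} {L} f A! = begin
    ∑ (words A (suc k)) (λ w → f w when does (avoids? a w))
      ≈⟨ ∑-words A k _ ⟩
    ∑ A (λ b → ∑ (words A k) (λ w → f (b ∷ w) when (does (¬? (a ≟ b)) ∧ does (avoids? a w))))
      ≈⟨ ∑-cong′ A inner ⟩
    ∑ A (λ b → ∑ (words (D ++ L) k) (f ∘ (b ∷_)) when does (¬? (a ≟ b)))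
      ≈⟨ ∑-drop-letter D _ A! ⟩
    ∑ (D ++ L) (λ b → ∑ (words (D ++ L) k) (f ∘ (b ∷_)))
      ≈⟨ ∑-words (D ++ L) k f ⟨
    ∑ (words (D ++ L) (suc k)) f ∎
    where
    A = D ++ a ∷ L
    inner : ∀ b → ∑ (words A k) (λ w → f (b ∷ w) when (does (¬? (a ≟ b)) ∧ does (avoids? a w)))
                  ≈ (∑ (words (D ++ L) k) (f ∘ (b ∷_)) when does (¬? (a ≟ b)))
    inner b with does (¬? (a ≟ b))
    ... | true  = ∑-words-avoiding k D (f ∘ (b ∷_)) A!
    ... | false = ∑-0 (words A k)

  -- The test on `a ∷ w` splits into `w` avoiding `a`, which amounts to deleting `a` from the
  -- alphabet, and uniqueness of `w`, which the induction handles.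
  ∑-words-unique : ∀ k A f → Unique A →
                   ∑ (words A k) (λ w → f w when does (unique? w)) ≈ ∑-arr k A f
  ∑-words-unique zero    A f A! = +-identityʳ _
  ∑-words-unique (suc k) A f A! = begin
    ∑ (words A (suc k)) (λ w → f w when does (unique? w))
      ≈⟨ ∑-words A k _ ⟩
    ∑ A (λ a → ∑ (words A k) (λ w → f (a ∷ w) when (does (avoids? a w) ∧ does (unique? w))))
      ≈⟨ ∑-as-∑-pick A _ _ (λ { D ≡.refl → first-letter D A! }) ⟩
    ∑-arr (suc k) A f ∎
    where
    first-letter : ∀ D {a L} → Unique (D ++ a ∷ L) →
      ∑ (words (D ++ a ∷ L) k) (λ w → f (a ∷ w) when (does (avoids? a w) ∧ does (unique? w)))
      ≈ ∑-arr k (D ++ L) (f ∘ (a ∷_))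
    first-letter D {a} {L} DaL! = begin
      ∑ (words (D ++ a ∷ L) k) (λ w → f (a ∷ w) when (does (avoids? a w) ∧ does (unique? w)))
        ≈⟨ ∑-cong′ (words (D ++ a ∷ L) k) (λ w → reflexive (when-∧ _ (does (avoids? a w)) _)) ⟩
      ∑ (words (D ++ a ∷ L) k) (λ w → (f (a ∷ w) when does (unique? w)) when does (avoids? a w))
        ≈⟨ ∑-words-avoiding k D _ DaL! ⟩
      ∑ (words (D ++ L) k) (λ w → f (a ∷ w) when does (unique? w))
        ≈⟨ ∑-words-unique k (D ++ L) _ (AllPairs-remove D DaL!) ⟩
      ∑-arr k (D ++ L) (f ∘ (a ∷_)) ∎

  -- The weight by ascending runs

  -- weight w is t ^ (number of ascending runs) if all runs have length at most 2,
  -- and 0 otherwise.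
  weight : List ℕ → Carrier
  -- The weight of what follows the run, if the run stops at `a`, respectively if it takes in
  -- exactly one more letter; otherwise 0. A longer run makes both vanish.
  close extend : ℕ → List ℕ → Carrier
  weight []       = 1#
  weight (a ∷ w)  = t * (close a w + extend a w)
  close a []      = 1#
  close a (b ∷ w) = if a <ᵇ b then 0# else weight (b ∷ w)
  extend a []      = 0#
  extend a (b ∷ w) = close b w when (a <ᵇ b)

  module _ {g} (g-emb : OrderEmbedding g) where
    weight-embed : ∀ w → weight (map g w) ≡ weight w
    close-embed  : ∀ a w → close (g a) (map g w) ≡ close a w
    extend-embed : ∀ a w → extend (g a) (map g w) ≡ extend a w
    weight-embed []       = ≡.refl
    weight-embed (a ∷ w)  = ≡.cong₂ (λ x y → t * (x + y)) (close-embed a w) (extend-embed a w)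
    close-embed a []      = ≡.refl
    close-embed a (b ∷ w) = ≡.cong₂ (if_then 0# else_) (g-emb a b) (weight-embed (b ∷ w))
    extend-embed a []      = ≡.refl
    extend-embed a (b ∷ w) = ≡.cong₂ _when_ (close-embed b w) (g-emb a b)

  W : ℕ → Carrier
  W n = ∑-arr n (upTo n) weight

  -- The weight sees only the relative order of the letters, so `A` may be standardised.
  ∑-arr-weight : ∀ {A m} → AllPairs _<_ A → length A ≡ m → ∑-arr m A weight ≈ W m
  ∑-arr-weight {A} A↗ ≡.refl with sorted⇒image 0 A A↗ (All.universal (λ _ → z≤n) A)
  ... | g , g-emb , _ , A≡ = begin
    ∑-arr m A weight                 ≡⟨ ≡.cong (λ B → ∑-arr m B weight) (≡.trans A≡ (≡.sym (map-upTo g m))) ⟩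
    ∑-arr m (map g (upTo m)) weight  ≈⟨ ∑-arr-map g m (upTo m) weight ⟩
    ∑-arr m (upTo m) (weight ∘ map g) ≈⟨ ∑-arr-cong m (upTo m) (λ w → reflexive (weight-embed g-emb w)) ⟩
    W m                              ∎
    where m = length A

  -- From descents and pattern avoidance to the weight

  term : ℕ → Bool → Carrier
  term d b = t ^ suc d when not b

  term-suc : ∀ d b → term (suc d) b ≈ t * term d b
  term-suc d false = refl
  term-suc d true  = sym (zeroʳ t)

  descent : ∀ {a b} → b < a → (if b <ᵇ a then 1 else 0) ≡ 1
  descent b<a = ≡.cong (if_then 1 else 0) (<⇒<ᵇ≡true b<a)

  ascent : ∀ {a b} → a < b → (if b <ᵇ a then 1 else 0) ≡ 0
  ascent a<b = ≡.cong (if_then 1 else 0) (≮⇒<ᵇ≡false (<-asym a<b))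

  weight-ascent : ∀ {a b} w → a < b → weight (a ∷ b ∷ w) ≈ t * close b w
  weight-ascent w a<b rewrite <⇒<ᵇ≡true a<b = *-congˡ (+-identityˡ _)

  weight-descent : ∀ {a b} w → ¬ a < b → weight (a ∷ b ∷ w) ≈ t * weight (b ∷ w)
  weight-descent w a≮b rewrite ≮⇒<ᵇ≡false a≮b = *-congˡ (+-identityʳ _)

  -- Between distinct neighbours every non-ascent is a descent, so there is one more run than there
  -- are descents; an occurrence of the pattern is a run of length at least 3. The cases are first
  -- runs of length 1, of length 2 and longer.
  term-weight : ∀ a w → Unique (a ∷ w) →
                term (des (a ∷ w)) (does (contains-123? (a ∷ w))) ≈ weight (a ∷ w)
  term-weight a []      _                    = *-congˡ (sym (+-identityʳ 1#))
  term-weight a (b ∷ w) ((a≢b ∷ _) ∷ bw!) with <-cmp a b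
  ... | tri≈ _ a≡b _ = contradiction a≡b a≢b
  ... | tri> a≮b _ b<a = begin
    term (des (a ∷ b ∷ w)) (does (contains-123? (a ∷ b ∷ w)))
      ≡⟨ ≡.cong₂ term (≡.cong (ℕ._+ des (b ∷ w)) (descent b<a))
                      (does-⇔ (mk⇔ skip there) (contains-123? (a ∷ b ∷ w)) (contains-123? (b ∷ w))) ⟩
    term (suc (des (b ∷ w))) (does (contains-123? (b ∷ w)))
      ≈⟨ term-suc (des (b ∷ w)) _ ⟩
    t * term (des (b ∷ w)) (does (contains-123? (b ∷ w)))
      ≈⟨ *-congˡ (term-weight b w bw!) ⟩
    t * weight (b ∷ w)
      ≈⟨ weight-descent w a≮b ⟨
    weight (a ∷ b ∷ w) ∎
    where
    skip : ∀ {w} → Contains-123 (a ∷ b ∷ w) → Contains-123 (b ∷ w)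
    skip (here a<b _) = contradiction a<b a≮b
    skip (there p)    = p
  term-weight a (b ∷ []) _ | tri< a<b _ _ = begin
    term (des (a ∷ b ∷ [])) false ≡⟨ ≡.cong (λ i → term (i ℕ.+ 0) false) (ascent a<b) ⟩
    t * 1#                        ≈⟨ weight-ascent [] a<b ⟨
    weight (a ∷ b ∷ [])           ∎
  term-weight a (b ∷ c ∷ w) (_ ∷ (b≢c ∷ _) ∷ cw!) | tri< a<b _ _ with <-cmp b c
  ... | tri≈ _ b≡c _ = contradiction b≡c b≢c
  ... | tri< b<c _ _ = begin
    term (des (a ∷ b ∷ c ∷ w)) (does (contains-123? (a ∷ b ∷ c ∷ w)))
      ≡⟨ ≡.cong (term (des (a ∷ b ∷ c ∷ w))) (dec-true (contains-123? (a ∷ b ∷ c ∷ w)) (here a<b b<c)) ⟩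
    0#
      ≈⟨ zeroʳ t ⟨
    t * 0#
      ≡⟨ ≡.cong (λ x → t * (if x then 0# else weight (c ∷ w))) (<⇒<ᵇ≡true b<c) ⟨
    t * close b (c ∷ w)
      ≈⟨ weight-ascent (c ∷ w) a<b ⟨
    weight (a ∷ b ∷ c ∷ w) ∎
  -- The first run is exactly `a`, `b`, so the induction continues two letters further, at `c ∷ w`.
  ... | tri> b≮c _ c<b = begin
    term (des (a ∷ b ∷ c ∷ w)) (does (contains-123? (a ∷ b ∷ c ∷ w)))
      ≡⟨ ≡.cong₂ term (≡.cong₂ (λ i j → i ℕ.+ (j ℕ.+ des (c ∷ w))) (ascent a<b) (descent c<b))
                      (does-⇔ (mk⇔ skip (there ∘ there)) (contains-123? (a ∷ b ∷ c ∷ w)) (contains-123? (c ∷ w))) ⟩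
    term (suc (des (c ∷ w))) (does (contains-123? (c ∷ w)))
      ≈⟨ term-suc (des (c ∷ w)) _ ⟩
    t * term (des (c ∷ w)) (does (contains-123? (c ∷ w)))
      ≈⟨ *-congˡ (term-weight c w cw!) ⟩
    t * weight (c ∷ w)
      ≡⟨ ≡.cong (λ x → t * (if x then 0# else weight (c ∷ w))) (≮⇒<ᵇ≡false b≮c) ⟨
    t * close b (c ∷ w)
      ≈⟨ weight-ascent (c ∷ w) a<b ⟨
    weight (a ∷ b ∷ c ∷ w) ∎
    where
    skip : Contains-123 (a ∷ b ∷ c ∷ w) → Contains-123 (c ∷ w)
    skip (here _ b<c)         = contradiction b<c b≮c
    skip (there (here b<c _)) = contradiction b<c b≮c
    skip (there (there p))    = p

  [1⋯_] : ℕ → List ℕ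
  [1⋯ n ] = map suc (upTo n)

  length-[1⋯] : ∀ n → length [1⋯ n ] ≡ n
  length-[1⋯] n = ≡.trans (length-map suc (upTo n)) (length-upTo n)

  [1⋯]-sorted : ∀ n → AllPairs _<_ [1⋯ n ]
  [1⋯]-sorted n = AllPairsₚ.map⁺ (AllPairsₚ.applyUpTo⁺₁ id n (λ i<j _ → s≤s i<j))

  -- Restricted to positive length: for the empty permutation the left side is `t`, whereas `W 0` is
  -- 1.
  ∑-𝔖-avoiding-123 : ∀ n → ∑ (𝔖-avoiding-123 (suc n)) (λ π → t ^ suc (des π)) ≈ W (suc n)
  ∑-𝔖-avoiding-123 n = begin
    ∑ (𝔖-avoiding-123 m) (λ π → t ^ suc (des π))
      ≈⟨ ∑-filter (λ π → ¬? (contains-123? π)) (𝔖 m) _ ⟩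
    ∑ (𝔖 m) val
      ≈⟨ ∑-filter unique? (words [1⋯ m ] m) val ⟩
    ∑ (words [1⋯ m ] m) (λ w → val w when does (unique? w))
      -- Splitting off the first letter exhibits the words as nonempty, as `term-weight` demands.
      ≈⟨ ∑-words [1⋯ m ] n _ ⟩
    ∑ [1⋯ m ] (λ a → ∑ (words [1⋯ m ] n) (λ w → val (a ∷ w) when does (unique? (a ∷ w))))
      ≈⟨ ∑-cong′ [1⋯ m ] (λ a → ∑-cong′ (words [1⋯ m ] n) (val-weight a)) ⟩
    ∑ [1⋯ m ] (λ a → ∑ (words [1⋯ m ] n) (λ w → weight (a ∷ w) when does (unique? (a ∷ w))))
      ≈⟨ ∑-words [1⋯ m ] n _ ⟨
    ∑ (words [1⋯ m ] m) (λ w → weight w when does (unique? w))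
      ≈⟨ ∑-words-unique m [1⋯ m ] weight (AllPairs.map <⇒≢ ([1⋯]-sorted m)) ⟩
    ∑-arr m [1⋯ m ] weight
      ≈⟨ ∑-arr-weight ([1⋯]-sorted m) (length-[1⋯] m) ⟩
    W m ∎
    where
    m = suc n

    val : List ℕ → Carrier
    val w = term (des w) (does (contains-123? w))

    val-weight : ∀ a w → (val (a ∷ w) when does (unique? (a ∷ w))) ≈ (weight (a ∷ w) when does (unique? (a ∷ w)))
    val-weight a w = when-cong (unique? (a ∷ w)) (term-weight a w)

  -- Deleting increasing prefixes

  -- ∑ₖ uₖ · weight of what remains of w after deleting its first k letters, over
  -- the k for which those letters are increasing and above lo.
  peel : (ℕ → Carrier) → ℕ → List ℕ → Carrier
  peel u lo []      = u 0
  peel u lo (a ∷ w) = u 0 * weight (a ∷ w) + (peel (u ∘ suc) a w when (lo <ᵇ a))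

  -- Induction along the first run. While the run goes on, the coefficients of `close b w` add up to
  -- the left side of the recurrence and cancel; where it stops, only deleting nothing and deleting
  -- just `a` contribute. The factor `u 1 + t * u 0` is kept because the induction passes to
  -- `u ∘ suc`, for which it need not vanish.
  peel-vanishes : ∀ u → (∀ n → u (2 ℕ.+ n) + t * (u (1 ℕ.+ n) + u n) ≈ 0#) →
                  ∀ {lo a} w → lo < a → peel u lo (a ∷ w) ≈ (u 1 + t * u 0) * close a w
  peel-vanishes u rec {lo} {a} w lo<a rewrite <⇒<ᵇ≡true lo<a = go u rec a w
    where
    go : ∀ u → (∀ n → u (2 ℕ.+ n) + t * (u (1 ℕ.+ n) + u n) ≈ 0#) →
         ∀ a w → u 0 * weight (a ∷ w) + peel (u ∘ suc) a w ≈ (u 1 + t * u 0) * close a w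
    go u rec a [] =
      solve 3 (λ t u₀ u₁ → u₀ :* (t :* (con 1 :+ con 0)) :+ u₁ := (u₁ :+ t :* u₀) :* con 1) refl t (u 0) (u 1)
    go u rec a (b ∷ w) with a <ᵇ b
    ... | true  = begin
      u 0 * (t * (0# + close b w)) + (u 1 * weight (b ∷ w) + peel (u ∘ suc ∘ suc) b w)
        ≈⟨ +-congˡ (go (u ∘ suc) (rec ∘ suc) b w) ⟩
      u 0 * (t * (0# + close b w)) + (u 2 + t * u 1) * close b w
        ≈⟨ solve 5 (λ t u₀ u₁ u₂ x → u₀ :* (t :* (con 0 :+ x)) :+ (u₂ :+ t :* u₁) :* x :=
                                     (u₂ :+ t :* (u₁ :+ u₀)) :* x) refl t (u 0) (u 1) (u 2) (close b w) ⟩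
      (u 2 + t * (u 1 + u 0)) * close b w
        ≈⟨ *-congʳ (rec 0) ⟩
      0# * close b w
        ≈⟨ zeroˡ _ ⟩
      0#
        ≈⟨ zeroʳ _ ⟨
      (u 1 + t * u 0) * 0# ∎
    ... | false =
      solve 4 (λ t u₀ u₁ x → u₀ :* (t :* (x :+ con 0)) :+ (u₁ :* x :+ con 0) := (u₁ :+ t :* u₀) :* x)
        refl t (u 0) (u 1) (weight (b ∷ w))

  -- With no letter above `lo`, only the empty prefix can be deleted.
  ∑-arr-peel-below : ∀ u {lo} m {A} → All (_≤ lo) A → ∑-arr m A (peel u lo) ≈ u 0 * ∑-arr m A weight
  ∑-arr-peel-below u zero    A≤lo = sym (*-identityʳ _)
  ∑-arr-peel-below u {lo} (suc m) {A} A≤lo = begin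
    ∑-arr (suc m) A (peel u lo)
      ≈⟨ ∑-pick-cong (All.map (λ a≤lo B → ∑-arr-cong m B (λ w → below w a≤lo)) A≤lo) ⟩
    ∑-arr (suc m) A (λ w → u 0 * weight w)
      ≈⟨ ∑-arr-* (u 0) (suc m) A weight ⟩
    u 0 * ∑-arr (suc m) A weight ∎
    where
    below : ∀ {a} w → a ≤ lo → peel u lo (a ∷ w) ≈ u 0 * weight (a ∷ w)
    below w a≤lo rewrite ≮⇒<ᵇ≡false (≤⇒≯ a≤lo) = +-identityʳ _

  -- Raising lo past the least letter x of L loses the words that start with x.
  ∑-arr-peel : ∀ u lo D L {m} → AllPairs _<_ (D ++ L) → All (_≤ lo) D → All (lo <_) L →
               length (D ++ L) ≡ m →
               ∑-arr m (D ++ L) (peel u lo) ≈ (u ⋆ (λ i → W (length D ℕ.+ i))) (length L)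
  ∑-arr-peel u lo D [] {m} D↗ D≤lo _ len = begin
    ∑-arr m (D ++ []) (peel u lo)    ≈⟨ ∑-arr-peel-below u m (Allₚ.++⁺ D≤lo []) ⟩
    u 0 * ∑-arr m (D ++ []) weight   ≈⟨ *-congˡ (∑-arr-weight D↗ len) ⟩
    u 0 * W m                        ≡⟨ ≡.cong (λ i → u 0 * W i) (≡.trans (≡.sym len) (length-++ D)) ⟩
    u 0 * W (length D ℕ.+ 0)         ∎
  ∑-arr-peel u lo D (x ∷ L) DxL↗ D≤lo (lo<x ∷ lo<L) len
    with ≡.trans (≡.sym (length-++-sucʳ D x L)) len | AllPairs-middle D DxL↗
  ... | ≡.refl | D<x , x<L = begin
    ∑-arr (suc m) (D ++ x ∷ L) (peel u lo)
      -- Tests against `lo` and against `x` agree for every first letter other than `x`: those in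
      -- `D` fail both, those in `L` pass both.
      ≈⟨ ∑-pick-perturb D (λ B → ∑-arr m B (peel (u ∘ suc) x))
           (All.zipWith (λ {a} (a<x , a≤lo) → same a
             (≡.trans (≮⇒<ᵇ≡false (≤⇒≯ a≤lo)) (≡.sym (≮⇒<ᵇ≡false (<-asym a<x))))) (D<x , D≤lo))
           (All.map (λ {a} x<a → same a (≡.trans (<⇒<ᵇ≡true (<-trans lo<x x<a)) (≡.sym (<⇒<ᵇ≡true x<a)))) x<L)
           starts-with-x ⟩
    ∑-arr (suc m) (D ++ x ∷ L) (peel u x) + ∑-arr m (D ++ L) (peel (u ∘ suc) x)
      -- These are the two branches of Pascal's rule: either `x` joins the letters that may not be
      -- deleted next, or it is deleted and leaves the alphabet while `u` is shifted.
      ≈⟨ +-cong raised (∑-arr-peel (u ∘ suc) x D L (AllPairs-remove D DxL↗) (All.map <⇒≤ D<x) x<L ≡.refl) ⟩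
    (u ⋆ (λ i → W (length D ℕ.+ suc i))) (length L) + (u ∘ suc ⋆ (λ i → W (length D ℕ.+ i))) (length L)
      ≈⟨ +-comm _ _ ⟩
    (u ∘ suc ⋆ (λ i → W (length D ℕ.+ i))) (length L) + (u ⋆ (λ i → W (length D ℕ.+ suc i))) (length L) ∎
    where
    m = length (D ++ L)

    same : ∀ a → (lo <ᵇ a) ≡ (x <ᵇ a) → ∀ B →
           ∑-arr m B (peel u lo ∘ (a ∷_)) ≈ ∑-arr m B (peel u x ∘ (a ∷_))
    same a eq B = ∑-arr-cong m B λ w →
      reflexive (≡.cong (λ b → u 0 * weight (a ∷ w) + (peel (u ∘ suc) a w when b)) eq)

    split : ∀ w → peel u lo (x ∷ w) ≈ peel u x (x ∷ w) + peel (u ∘ suc) x w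
    split w rewrite <⇒<ᵇ≡true lo<x | ≮⇒<ᵇ≡false (<-irrefl {x} ≡.refl) =
      +-congʳ (sym (+-identityʳ _))

    starts-with-x : ∀ B → ∑-arr m B (peel u lo ∘ (x ∷_)) ≈
                          ∑-arr m B (peel u x ∘ (x ∷_)) + ∑-arr m B (peel (u ∘ suc) x)
    starts-with-x B = trans (∑-arr-cong m B split) (∑-arr-+ m B _ _)

    snoc : (D ++ x ∷ []) ++ L ≡ D ++ x ∷ L
    snoc = ++-assoc D (x ∷ []) L

    raised : ∑-arr (suc m) (D ++ x ∷ L) (peel u x) ≈ (u ⋆ (λ i → W (length D ℕ.+ suc i))) (length L)
    raised = begin
      ∑-arr (suc m) (D ++ x ∷ L) (peel u x)
        ≡⟨ ≡.cong (λ A → ∑-arr (suc m) A (peel u x)) snoc ⟨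
      ∑-arr (suc m) ((D ++ x ∷ []) ++ L) (peel u x)
        ≈⟨ ∑-arr-peel u x (D ++ x ∷ []) L (≡.subst (AllPairs _<_) (≡.sym snoc) DxL↗)
             (Allₚ.++⁺ (All.map <⇒≤ D<x) (≤-refl ∷ [])) x<L
             (≡.trans (≡.cong length snoc) (length-++-sucʳ D x L)) ⟩
      (u ⋆ (λ i → W (length (D ++ x ∷ []) ℕ.+ i))) (length L)
        ≈⟨ ⋆-cong (λ _ → refl) (λ i → reflexive (≡.cong W (shift i))) (length L) ⟩
      (u ⋆ (λ i → W (length D ℕ.+ suc i))) (length L) ∎
      where
      shift : ∀ i → length (D ++ x ∷ []) ℕ.+ i ≡ length D ℕ.+ suc i
      shift i = ≡.trans (≡.cong (ℕ._+ i) (length-++ D)) (ℕₚ.+-assoc (length D) 1 i)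

  -- The sum of `peel u 0` over all permutations, computed in two ways: by `∑-arr-peel` with `D`
  -- empty it is the convolution, and by `peel-vanishes` every summand is zero. The threshold 0 lies
  -- below every letter.
  ⋆-weights : ∀ u → (∀ n → u (2 ℕ.+ n) + t * (u (1 ℕ.+ n) + u n) ≈ 0#) → u 1 + t * u 0 ≈ 0# →
              ∀ n → (u ⋆ W) (suc n) ≈ 0#
  ⋆-weights u rec u₁ n = begin
    (u ⋆ W) (suc n)
      ≡⟨ ≡.cong (u ⋆ W) (length-[1⋯] (suc n)) ⟨
    (u ⋆ W) (length A)
      ≈⟨ ∑-arr-peel u 0 [] A ([1⋯]-sorted (suc n)) [] A>0 (length-[1⋯] (suc n)) ⟨
    ∑-arr (suc n) A (peel u 0)
      ≈⟨ ∑-pick-cong (All.map (λ a>0 B → ∑-arr-cong n B (λ w → vanish w a>0)) A>0) ⟩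
    -- Zero is written as a product so that a factor 0 can be pulled out of the sum.
    ∑-arr (suc n) A (λ _ → 0# * 0#)
      ≈⟨ ∑-arr-* 0# (suc n) A (λ _ → 0#) ⟩
    0# * ∑-arr (suc n) A (λ _ → 0#)
      ≈⟨ zeroˡ _ ⟩
    0# ∎
    where
    A = [1⋯ suc n ]

    A>0 : All (0 <_) A
    A>0 = Allₚ.map⁺ (All.universal (λ _ → z<s) (upTo (suc n)))

    vanish : ∀ {a} w → 0 < a → peel u 0 (a ∷ w) ≈ 0# * 0#
    vanish {a} w a>0 = begin
      peel u 0 (a ∷ w)             ≈⟨ peel-vanishes u rec w a>0 ⟩
      (u 1 + t * u 0) * close a w  ≈⟨ *-congʳ u₁ ⟩
      0# * close a w               ≈⟨ zeroˡ _ ⟩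
      0#                           ≈⟨ zeroˡ _ ⟨
      0# * 0#                      ∎

-- Rational arithmetic, verified on unnormalised fractions

toℚᵘ-/ : ∀ i n .{{_ : NonZero n}} → ℚ.toℚᵘ (i ℚ./ n) ℚᵘ.≃ i ℚᵘ./ n
toℚᵘ-/ i (suc n) = ℚₚ.toℚᵘ-fromℚᵘ (mkℚᵘ i n)

suc/1 : ∀ n → + suc n ℚ./ 1 ≡ 1ℚ ℚ.+ + n ℚ./ 1
suc/1 n = ℚₚ.toℚᵘ-injective (begin-equality
  ℚ.toℚᵘ (+ suc n ℚ./ 1)                   ≃⟨ toℚᵘ-/ (+ suc n) 1 ⟩
  + suc n ℚᵘ./ 1                           ≃⟨ *≡* (≡.cong (ℤ._* + 1) (≡.cong (ℤ._+_ (+ 1)) (≡.sym (ℤₚ.*-identityʳ (+ n))))) ⟩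
  ℚᵘ.1ℚᵘ ℚᵘ.+ + n ℚᵘ./ 1                   ≃⟨ ℚᵘₚ.+-congʳ ℚᵘ.1ℚᵘ (toℚᵘ-/ (+ n) 1) ⟨
  ℚᵘ.1ℚᵘ ℚᵘ.+ ℚ.toℚᵘ (+ n ℚ./ 1)           ≃⟨ ℚₚ.toℚᵘ-homo-+ 1ℚ (+ n ℚ./ 1) ⟨
  ℚ.toℚᵘ (1ℚ ℚ.+ + n ℚ./ 1)                ∎)
  where open ℚᵘₚ.≤-Reasoning

-- Yields the step from 1/(n+1)! to 1/n! and, with `m` equal to 1, the inverses of positive
-- integers.
n*1/nm : ∀ n m .{{_ : NonZero n}} .{{_ : NonZero m}} .{{_ : NonZero (n ℕ.* m)}} →
         (+ n ℚ./ 1) ℚ.* (+ 1 ℚ./ (n ℕ.* m)) ≡ + 1 ℚ./ m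
n*1/nm (suc n) (suc m) = ℚₚ.toℚᵘ-injective (begin-equality
  ℚ.toℚᵘ ((+ suc n ℚ./ 1) ℚ.* (+ 1 ℚ./ nm))             ≃⟨ ℚₚ.toℚᵘ-homo-* (+ suc n ℚ./ 1) (+ 1 ℚ./ nm) ⟩
  ℚ.toℚᵘ (+ suc n ℚ./ 1) ℚᵘ.* ℚ.toℚᵘ (+ 1 ℚ./ nm)       ≃⟨ ℚᵘₚ.*-cong (toℚᵘ-/ (+ suc n) 1) (toℚᵘ-/ (+ 1) nm) ⟩
  (+ suc n ℚᵘ./ 1) ℚᵘ.* (+ 1 ℚᵘ./ nm)                   ≃⟨ *≡* cross ⟩
  + 1 ℚᵘ./ suc m                                        ≃⟨ toℚᵘ-/ (+ 1) (suc m) ⟨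
  ℚ.toℚᵘ (+ 1 ℚ./ suc m)                                ∎)
  where
  open ℚᵘₚ.≤-Reasoning
  nm = suc n ℕ.* suc m
  cross : (+ suc n ℤ.* + 1) ℤ.* + suc m ≡ + 1 ℤ.* (+ 1 ℤ.* + nm)
  cross = ≡.trans (≡.cong (ℤ._* + suc m) (ℤₚ.*-identityʳ (+ suc n)))
            (≡.sym (≡.trans (ℤₚ.*-identityˡ (+ 1 ℤ.* + nm)) (≡.trans (ℤₚ.*-identityˡ (+ nm)) (ℤₚ.pos-* (suc n) (suc m)))))

-- Integers and reciprocal factorials in the extension field

module ExtensionProperties {c ℓ₁ ℓ₂} (K : Extension c ℓ₁ ℓ₂) where
  open Extension K
  open PowerSeries K
  open CommutativeRing commutativeRing using (commutativeSemiring)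
  open BinomialConvolution commutativeSemiring
  open RunTheorem commutativeSemiring t
    using (W; ∑-𝔖-avoiding-123; ⋆-weights)
  open RingProperties (CommutativeRing.ring commutativeRing) using (-0#≈0#)
  open SemiringExp (CommutativeRing.semiring commutativeRing) using (^-congˡ)
  open RingMorphisms.IsRingHomomorphism ι-isHomomorphism using ()
    renaming (+-homo to ι-+; *-homo to ι-*; -‿homo to ι--; 0#-homo to ι-0; 1#-homo to ι-1)
  open import Relation.Binary.Reasoning.Setoid (CommutativeRing.setoid commutativeRing)

  -- Gives the ring solver rational coefficients, so that it can compute with ½ and 4.
  ι-morphism : ℚ.+-*-rawRing -Raw-AlmostCommutative⟶ fromCommutativeRing commutativeRing
  ι-morphism = record
    { ⟦_⟧ = ι ; +-homo = ι-+ ; *-homo = ι-* ; -‿homo = ι-- ; 0-homo = ι-0 ; 1-homo = ι-1 }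

  ι-weaklyDec : WeaklyDecidable (Induced-equivalence ι-morphism)
  ι-weaklyDec p q = Maybe.map (λ p≡q → reflexive (≡.cong ι p≡q)) (dec⇒weaklyDec ℚₚ._≟_ p q)

  open RingSolver ℚ.+-*-rawRing (fromCommutativeRing commutativeRing) ι-morphism ι-weaklyDec
    using (solve; con; _:=_; _:+_; _:*_; _:-_; :-_)

  open SemiringSolver commutativeSemiring using () renaming
    (solve to ℕ-solve; con to con′; _:=_ to _⊜′_; _:+_ to _⊕′_; _:*_ to _⊗′_)

  ν : ℕ → Carrier
  ν n = ι (+ n ℚ./ 1)

  ν-suc : ∀ n → ν (suc n) ≈ 1# + ν n
  ν-suc n = begin
    ι (+ suc n ℚ./ 1)       ≡⟨ ≡.cong ι (suc/1 n) ⟩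
    ι (1ℚ ℚ.+ + n ℚ./ 1)    ≈⟨ ι-+ 1ℚ (+ n ℚ./ 1) ⟩
    ι 1ℚ + ν n              ≈⟨ +-congʳ ι-1 ⟩
    1# + ν n                ∎

  1/ : ∀ n .{{_ : NonZero n}} → Carrier
  1/ n = ι (+ 1 ℚ./ n)

  ν*1/ : ∀ n m .{{_ : NonZero n}} .{{_ : NonZero m}} .{{_ : NonZero (n ℕ.* m)}} →
         ν n * 1/ (n ℕ.* m) ≈ 1/ m
  ν*1/ n m = trans (sym (ι-* (+ n ℚ./ 1) (+ 1 ℚ./ (n ℕ.* m)))) (reflexive (≡.cong ι (n*1/nm n m)))

  1/! : ℕ → Carrier
  1/! n = 1/ (n !) {{n !≢0}}

  1/!-suc : ∀ n → ν (suc n) * 1/! (suc n) ≈ 1/! n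
  1/!-suc n = ν*1/ (suc n) (n !) {{_}} {{n !≢0}} {{suc n !≢0}}

  ν-suc-cancel : ∀ n {x y} → ν (suc n) * x ≈ ν (suc n) * y → x ≈ y
  ν-suc-cancel n {x} {y} eq = begin
    x                       ≈⟨ unit x ⟨
    i * (ν (suc n) * x)     ≈⟨ *-congˡ eq ⟩
    i * (ν (suc n) * y)     ≈⟨ unit y ⟩
    y                       ∎
    where
    -- The factor 1 gives the denominator the shape that `ν*1/` expects.
    i = 1/ (suc n ℕ.* 1)
    unit : ∀ z → i * (ν (suc n) * z) ≈ z
    unit z = begin
      i * (ν (suc n) * z)   ≈⟨ solve 3 (λ i v z → i :* (v :* z) := v :* i :* z) refl i (ν (suc n)) z ⟩
      ν (suc n) * i * z     ≈⟨ *-congʳ (trans (ν*1/ (suc n) 1) ι-1) ⟩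
      1# * z                ≈⟨ *-identityˡ z ⟩
      z                     ∎

  -- Cauchy products and the Euler operator

  ⊛-cong : ∀ {f f′ g g′} → f ≋ f′ → g ≋ g′ → f ⊛ g ≋ f′ ⊛ g′
  ⊛-cong f≋ g≋ zero    = +-congʳ (*-cong (f≋ 0) (g≋ 0))
  ⊛-cong f≋ g≋ (suc n) = +-cong (*-cong (f≋ 0) (g≋ (suc n))) (⊛-cong (f≋ ∘ suc) g≋ n)

  ⊛-congˡ : ∀ f {g g′} → g ≋ g′ → f ⊛ g ≋ f ⊛ g′
  ⊛-congˡ f = ⊛-cong {f} {f} (λ _ → refl)

  ⊛-congʳ : ∀ g {f f′} → f ≋ f′ → f ⊛ g ≋ f′ ⊛ g
  ⊛-congʳ g f≋f′ = ⊛-cong {g = g} {g} f≋f′ (λ _ → refl)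

  ⊛-zeroˡ : ∀ g n → ((λ _ → 0#) ⊛ g) n ≈ 0#
  ⊛-zeroˡ g zero    = trans (+-identityʳ _) (zeroˡ _)
  ⊛-zeroˡ g (suc n) = trans (+-cong (zeroˡ _) (⊛-zeroˡ g n)) (+-identityˡ 0#)

  const-⊛ : ∀ a g n → (const a ⊛ g) n ≈ a * g n
  const-⊛ a g zero    = +-identityʳ _
  const-⊛ a g (suc n) = trans (+-congˡ (⊛-zeroˡ g n)) (+-identityʳ _)

  ⊛-const : ∀ f a n → (f ⊛ const a) n ≈ f n * a
  ⊛-const f a zero    = +-identityʳ _
  ⊛-const f a (suc n) = trans (+-cong (zeroʳ _) (⊛-const (f ∘ suc) a n)) (+-identityˡ _)

  ⊛-shiftʳ : ∀ f g → g 0 ≈ 0# → ∀ n → (f ⊛ g) (suc n) ≈ (f ⊛ g ∘ suc) n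
  ⊛-shiftʳ f g g₀ zero    = +-congˡ (trans (+-identityʳ _) (trans (*-congˡ g₀) (zeroʳ _)))
  ⊛-shiftʳ f g g₀ (suc n) = +-congˡ (⊛-shiftʳ (f ∘ suc) g g₀ n)

  -- The operator x d/dx. Unlike d/dx it preserves the index, which suits the Leibniz rule for
  -- coefficients of a Cauchy product.
  θ : Series → Series
  θ f n = ν n * f n

  ν-0 : ν 0 ≈ 0#
  ν-0 = ι-0

  -- The summand x is needed because removing the head of f shifts its index by one.
  ⊛-leibniz : ∀ x f g n → (x + ν n) * (f ⊛ g) n ≈ ((λ k → (x + ν k) * f k) ⊛ g) n + (f ⊛ θ g) n
  ⊛-leibniz x f g zero = begin
    (x + ν 0) * (f 0 * g 0 + 0#)
      ≈⟨ ℕ-solve 4 (λ x v a b → (x ⊕′ v) ⊗′ (a ⊗′ b ⊕′ con′ 0) ⊜′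
                                ((x ⊕′ v) ⊗′ a ⊗′ b ⊕′ con′ 0) ⊕′ con′ 0) refl x (ν 0) (f 0) (g 0) ⟩
    (x + ν 0) * f 0 * g 0 + 0# + 0#
      ≈⟨ +-congˡ (trans (+-identityʳ _) (trans (*-congˡ (trans (*-congʳ ν-0) (zeroˡ _))) (zeroʳ _))) ⟨
    (x + ν 0) * f 0 * g 0 + 0# + (f 0 * (ν 0 * g 0) + 0#) ∎
  ⊛-leibniz x f g (suc n) = begin
    (x + ν (suc n)) * (f 0 * g (suc n) + (f ∘ suc ⊛ g) n)
      ≈⟨ ℕ-solve 5 (λ x v a b c → (x ⊕′ v) ⊗′ (a ⊗′ b ⊕′ c) ⊜′
                                  ((x ⊕′ con′ 0) ⊗′ a ⊗′ b ⊕′ a ⊗′ (v ⊗′ b)) ⊕′ (x ⊕′ v) ⊗′ c)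
               refl x (ν (suc n)) (f 0) (g (suc n)) _ ⟩
    (x + 0#) * f 0 * g (suc n) + f 0 * θ g (suc n) + (x + ν (suc n)) * (f ∘ suc ⊛ g) n
      ≈⟨ +-cong (+-congʳ (*-congʳ (*-congʳ (+-congˡ (sym ν-0))))) (*-congʳ (shift n)) ⟩
    (x + ν 0) * f 0 * g (suc n) + f 0 * θ g (suc n) + (x + 1# + ν n) * (f ∘ suc ⊛ g) n
      ≈⟨ +-congˡ (⊛-leibniz (x + 1#) (f ∘ suc) g n) ⟩
    (x + ν 0) * f 0 * g (suc n) + f 0 * θ g (suc n)
      + (((λ k → (x + 1# + ν k) * f (suc k)) ⊛ g) n + (f ∘ suc ⊛ θ g) n)
      ≈⟨ +-congˡ (+-congʳ (⊛-congʳ g (λ k → *-congʳ {f (suc k)} (sym (shift k))) n)) ⟩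
    (x + ν 0) * f 0 * g (suc n) + f 0 * θ g (suc n)
      + (((λ k → (x + ν (suc k)) * f (suc k)) ⊛ g) n + (f ∘ suc ⊛ θ g) n)
      ≈⟨ ℕ-solve 4 (λ a b c d → (a ⊕′ b) ⊕′ (c ⊕′ d) ⊜′ (a ⊕′ c) ⊕′ (b ⊕′ d)) refl _ _ _ _ ⟩
    (x + ν 0) * f 0 * g (suc n) + ((λ k → (x + ν (suc k)) * f (suc k)) ⊛ g) n
      + (f 0 * θ g (suc n) + (f ∘ suc ⊛ θ g) n) ∎
    where
    shift : ∀ k → x + ν (suc k) ≈ x + 1# + ν k
    shift k = trans (+-congˡ (ν-suc k)) (sym (+-assoc _ _ _))

  θ-⊛ : ∀ f g n → θ (f ⊛ g) n ≈ (θ f ⊛ g) n + (f ⊛ θ g) n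
  θ-⊛ f g n = begin
    ν n * (f ⊛ g) n
      ≈⟨ *-congʳ (+-identityˡ _) ⟨
    (0# + ν n) * (f ⊛ g) n
      ≈⟨ ⊛-leibniz 0# f g n ⟩
    ((λ k → (0# + ν k) * f k) ⊛ g) n + (f ⊛ θ g) n
      ≈⟨ +-congʳ (⊛-congʳ g (λ k → *-congʳ {f k} (+-identityˡ (ν k))) n) ⟩
    (θ f ⊛ g) n + (f ⊛ θ g) n ∎

  θ-0 : ∀ f → θ f 0 ≈ 0#
  θ-0 f = trans (*-congʳ ν-0) (zeroˡ _)

  -- Exponential generating functions

  θ-egf : ∀ u n → θ (egf u) (suc n) ≈ egf (u ∘ suc) n
  θ-egf u n = trans (sym (*-assoc _ _ _)) (*-congʳ (1/!-suc n))

  egf-cong : ∀ {u v} → (∀ n → u n ≈ v n) → egf u ≋ egf v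
  egf-cong u≈v n = *-congˡ (u≈v n)

  egf-0 : ∀ u → egf u 0 ≈ u 0
  egf-0 u = trans (*-congʳ ι-1) (*-identityˡ _)

  -- The Leibniz rule for `θ` turns into the recursion that defines `_⋆_`. It determines the
  -- coefficient at `suc n` up to the factor `suc n`, which is invertible in the field.
  egf-⊛ : ∀ u v → egf u ⊛ egf v ≋ egf (u ⋆ v)
  egf-⊛ u v zero    = trans (+-identityʳ _) (trans (*-cong (egf-0 u) (egf-0 v)) (sym (egf-0 (u ⋆ v))))
  egf-⊛ u v (suc n) = ν-suc-cancel n (begin
    θ (egf u ⊛ egf v) (suc n)
      ≈⟨ θ-⊛ (egf u) (egf v) (suc n) ⟩
    (θ (egf u) ⊛ egf v) (suc n) + (egf u ⊛ θ (egf v)) (suc n)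
      ≈⟨ +-cong (trans (+-congʳ (trans (*-congʳ (θ-0 (egf u))) (zeroˡ _))) (+-identityˡ _))
                (⊛-shiftʳ (egf u) (θ (egf v)) (θ-0 (egf v)) n) ⟩
    (θ (egf u) ∘ suc ⊛ egf v) n + (egf u ⊛ θ (egf v) ∘ suc) n
      ≈⟨ +-cong (⊛-congʳ (egf v) (θ-egf u) n) (⊛-congˡ (egf u) (θ-egf v) n) ⟩
    (egf (u ∘ suc) ⊛ egf v) n + (egf u ⊛ egf (v ∘ suc)) n
      ≈⟨ +-cong (egf-⊛ (u ∘ suc) v n) (egf-⊛ u (v ∘ suc) n) ⟩
    egf (u ∘ suc ⋆ v) n + egf (u ⋆ v ∘ suc) n
      ≈⟨ distribˡ _ _ _ ⟨
    egf ((u ⋆ v) ∘ suc) n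
      ≈⟨ θ-egf (u ⋆ v) n ⟨
    θ (egf (u ⋆ v)) (suc n) ∎)

  egf-0^ : egf (0# ^_) ≋ 𝟙
  egf-0^ zero    = egf-0 (0# ^_)
  egf-0^ (suc n) = trans (*-congˡ (zeroˡ _)) (zeroʳ _)

  -- Inverses and square roots in the field

  private
    p = √t
    q = √[t-4]
    s = √[t²-4t]
    h = ι ½
    σ = h * s
    τ = t * h

  -- Apartness provides an inverse of the difference `x - 0#`, which is then transported to `y`.
  #0⇒invertible : ∀ {x y} → x # 0# → x ≈ y → Invertible _≈_ 1# _*_ y
  #0⇒invertible {x} {y} x#0 x≈y with #⇒invertible x#0
  ... | x⁻¹ , invˡ , invʳ = x⁻¹ , trans (*-congˡ y≈) invˡ , trans (*-congʳ y≈) invʳ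
    where
    y≈ : y ≈ x - 0#
    y≈ = begin
      y       ≈⟨ x≈y ⟨
      x       ≈⟨ +-identityʳ x ⟨
      x + 0#  ≈⟨ +-congˡ -0#≈0# ⟨
      x - 0#  ∎

  -- Used for the polynomials X and X - 4, whose values at the transcendental `t` are apart from 0.
  eval-linear : ∀ a → eval-at-t (a ∷ 1ℚ ∷ []) ≈ ι a + t
  eval-linear a = +-congˡ (begin
    t * (ι 1ℚ + t * 0#)  ≈⟨ *-congˡ (+-cong ι-1 (zeroʳ t)) ⟩
    t * (1# + 0#)        ≈⟨ *-congˡ (+-identityʳ 1#) ⟩
    t * 1#               ≈⟨ *-identityʳ t ⟩
    t                    ∎)

  t-invertible : Invertible _≈_ 1# _*_ t
  t-invertible = #0⇒invertible (t-transcendental (0ℚ ∷ 1ℚ ∷ []) (Any.there (Any.here λ ())))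
    (trans (eval-linear 0ℚ) (solve 1 (λ t → con 0ℚ :+ t := t) refl t))

  [t-4]-invertible : Invertible _≈_ 1# _*_ (t - 4#)
  [t-4]-invertible = #0⇒invertible (t-transcendental (ℚ.- (+ 4 ℚ./ 1) ∷ 1ℚ ∷ []) (Any.there (Any.here λ ())))
    (trans (eval-linear _)
      (solve 1 (λ t → con (ℚ.- (+ 4 ℚ./ 1)) :+ t := t :- con (+ 4 ℚ./ 1)) refl t))

  -- Transcendence yields the inverse of `t - 4#`; that of its square root is √(t-4)/(t-4).
  q⁻¹ : Carrier
  q⁻¹ = q * proj₁ [t-4]-invertible

  qq⁻¹ : q * q⁻¹ ≈ 1#
  qq⁻¹ = begin
    q * (q * u)   ≈⟨ *-assoc q q u ⟨
    q * q * u     ≈⟨ *-congʳ √[t-4]-square ⟩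
    (t - 4#) * u  ≈⟨ proj₂ (proj₂ [t-4]-invertible) ⟩
    1#            ∎
    where u = proj₁ [t-4]-invertible

  -- The reciprocal sequence in closed form

  private
    r₁ = σ - τ
    r₂ = - σ - τ
    α = h * (q - p)
    β = h * (q + p)

  exponentials : Carrier → Carrier → ℕ → Carrier
  exponentials a b n = α * a ^ n + β * b ^ n

  ⋆-exponentials : ∀ a b x n → ((x ^_) ⋆ exponentials a b) n ≈ exponentials (x + a) (x + b) n
  ⋆-exponentials a b x n = begin
    ((x ^_) ⋆ exponentials a b) n
      ≈⟨ ⋆-distribˡ (x ^_) (λ i → α * a ^ i) (λ i → β * b ^ i) n ⟩
    ((x ^_) ⋆ (λ i → α * a ^ i)) n + ((x ^_) ⋆ (λ i → β * b ^ i)) n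
      ≈⟨ +-cong (⋆-scaleʳ α (x ^_) (a ^_) n) (⋆-scaleʳ β (x ^_) (b ^_) n) ⟩
    α * ((x ^_) ⋆ (a ^_)) n + β * ((x ^_) ⋆ (b ^_)) n
      ≈⟨ +-cong (*-congˡ (⋆-power x a n)) (*-congˡ (⋆-power x b n)) ⟩
    exponentials (x + a) (x + b) n ∎

  exponentials-cong : ∀ {a a′ b b′} → a ≈ a′ → b ≈ b′ → ∀ n → exponentials a b n ≈ exponentials a′ b′ n
  exponentials-cong a≈ b≈ n = +-cong (*-congˡ (^-congˡ n a≈)) (*-congˡ (^-congˡ n b≈))

  -- The solution of wₙ₊₂ = -t (wₙ₊₁ + wₙ), w₀ = 1, w₁ = -t.
  w : ℕ → Carrier
  w n = q⁻¹ * exponentials r₁ r₂ n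

  -- Completing the square in X² + tX + t, whose discriminant is t² - 4t. The hypothesis on `y²`
  -- covers both signs of `σ`.
  root : ∀ y → y * y ≈ σ * σ → (y - τ) * (y - τ) + t * (y - τ + 1#) ≈ 0#
  root y y²≈σ² = begin
    (y - τ) * (y - τ) + t * (y - τ + 1#)
      ≈⟨ +-congˡ (*-congˡ (+-congˡ ι-1)) ⟨
    (y - τ) * (y - τ) + t * (y - τ + ι 1ℚ)
      ≈⟨ solve 2 (λ y t → (y :- t :* con ½) :* (y :- t :* con ½) :+ t :* (y :- t :* con ½ :+ con 1ℚ)
                          := y :* y :- con ½ :* con ½ :* (t :* t :- con (+ 4 ℚ./ 1) :* t)) refl y t ⟩
    y * y - h * h * (t * t - 4# * t)
      ≈⟨ +-cong y²≈σ² (-‿cong (*-congˡ (sym √[t²-4t]-square))) ⟩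
    h * s * (h * s) - h * h * (s * s)
      ≈⟨ solve 2 (λ h s → h :* s :* (h :* s) :- h :* h :* (s :* s) := con 0ℚ) refl h s ⟩
    ι 0ℚ
      ≈⟨ ι-0 ⟩
    0# ∎

  w-0 : w 0 ≈ 1#
  w-0 = begin
    q⁻¹ * (α * 1# + β * 1#)  ≈⟨ *-congˡ (+-cong (*-identityʳ α) (*-identityʳ β)) ⟩
    q⁻¹ * (α + β)            ≈⟨ solve 3 (λ i p q → i :* (con ½ :* (q :- p) :+ con ½ :* (q :+ p)) := q :* i) refl q⁻¹ p q ⟩
    q * q⁻¹                  ≈⟨ qq⁻¹ ⟩
    1#                       ∎

  -- The left side is a multiple of t√(t-4) - √(t²-4t)√t, which vanishes by the choice √(t²-4t) =
  -- √t√(t-4); this fixes the sign of the root.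
  w-1 : w 1 + t * w 0 ≈ 0#
  w-1 = begin
    q⁻¹ * (α * (r₁ * 1#) + β * (r₂ * 1#)) + t * (q⁻¹ * (α * 1# + β * 1#))
      ≈⟨ +-cong (*-congˡ (+-cong (*-congˡ (*-identityʳ r₁)) (*-congˡ (*-identityʳ r₂))))
                (*-congˡ (*-congˡ (+-cong (*-identityʳ α) (*-identityʳ β)))) ⟩
    q⁻¹ * (α * r₁ + β * r₂) + t * (q⁻¹ * (α + β))
      ≈⟨ solve 5 (λ i p q s t →
           i :* (con ½ :* (q :- p) :* (con ½ :* s :- t :* con ½) :+ con ½ :* (q :+ p) :* (:- (con ½ :* s) :- t :* con ½))
             :+ t :* (i :* (con ½ :* (q :- p) :+ con ½ :* (q :+ p)))
           := con ½ :* i :* (t :* q :- s :* p)) refl q⁻¹ p q s t ⟩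
    h * q⁻¹ * (t * q - s * p)
      ≈⟨ *-congˡ (+-cong (*-congʳ √t-square) (-‿cong (*-congʳ (sym √[t²-4t]-choice)))) ⟨
    h * q⁻¹ * (p * p * q - p * q * p)
      ≈⟨ *-congˡ (+-congʳ (solve 2 (λ p q → p :* p :* q := p :* q :* p) refl p q)) ⟩
    h * q⁻¹ * (p * q * p - p * q * p)
      ≈⟨ *-congˡ (-‿inverseʳ _) ⟩
    h * q⁻¹ * 0#
      ≈⟨ zeroʳ _ ⟩
    0# ∎

  -- Each of the two powers solves the recurrence by itself, its base being a root of the
  -- characteristic polynomial.
  w-rec : ∀ n → w (2 ℕ.+ n) + t * (w (1 ℕ.+ n) + w n) ≈ 0#
  w-rec n = begin
    w (2 ℕ.+ n) + t * (w (1 ℕ.+ n) + w n)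
      ≈⟨ ℕ-solve 8 (λ i α β r₁ r₂ x y t →
           i ⊗′ (α ⊗′ (r₁ ⊗′ (r₁ ⊗′ x)) ⊕′ β ⊗′ (r₂ ⊗′ (r₂ ⊗′ y)))
             ⊕′ t ⊗′ (i ⊗′ (α ⊗′ (r₁ ⊗′ x) ⊕′ β ⊗′ (r₂ ⊗′ y)) ⊕′ i ⊗′ (α ⊗′ x ⊕′ β ⊗′ y))
           ⊜′ i ⊗′ (α ⊗′ x ⊗′ (r₁ ⊗′ r₁ ⊕′ t ⊗′ (r₁ ⊕′ con′ 1))
                    ⊕′ β ⊗′ y ⊗′ (r₂ ⊗′ r₂ ⊕′ t ⊗′ (r₂ ⊕′ con′ 1))))
           refl q⁻¹ α β r₁ r₂ (r₁ ^ n) (r₂ ^ n) t ⟩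
    q⁻¹ * (α * r₁ ^ n * (r₁ * r₁ + t * (r₁ + 1#)) + β * r₂ ^ n * (r₂ * r₂ + t * (r₂ + 1#)))
      ≈⟨ *-congˡ (+-cong (trans (*-congˡ (root σ refl)) (zeroʳ _)) (trans (*-congˡ (root (- σ) -σ²)) (zeroʳ _))) ⟩
    q⁻¹ * (0# + 0#)
      ≈⟨ *-congˡ (+-identityˡ 0#) ⟩
    q⁻¹ * 0#
      ≈⟨ zeroʳ _ ⟩
    0# ∎
    where
    -σ² : - σ * - σ ≈ σ * σ
    -σ² = solve 1 (λ x → :- x :* :- x := x :* x) refl σ

  w⋆W : ∀ n → (w ⋆ W) n ≈ 0# ^ n
  w⋆W zero    = trans (*-identityʳ (w 0)) w-0
  w⋆W (suc n) = trans (⋆-weights w w-rec w-1 n) (sym (zeroˡ _))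

  -- Numerator and denominator as exponential generating functions

  N N⁻¹ D⁻¹ : ℕ → Carrier
  N n   = q * τ ^ n
  N⁻¹ n = q⁻¹ * (- τ) ^ n
  -- The denominator will turn out to be the numerator times the series of `w`, and `W` inverts `w`.
  D⁻¹   = W ⋆ N⁻¹

  numerator-egf : numerator ≋ egf N
  numerator-egf n = begin
    (exp τ ⊛ const q) n     ≈⟨ ⊛-const (exp τ) q n ⟩
    1/! n * τ ^ n * q       ≈⟨ ℕ-solve 3 (λ e x q → e ⊗′ x ⊗′ q ⊜′ e ⊗′ (q ⊗′ x)) refl (1/! n) (τ ^ n) q ⟩
    1/! n * (q * τ ^ n)     ∎

  -- The factor e^{tx/2} moves the exponents `r₁` and `r₂` to `σ` and `- σ`, and `q` cancels `q⁻¹`.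
  N⋆w : ∀ n → (N ⋆ w) n ≈ exponentials σ (- σ) n
  N⋆w n = begin
    (N ⋆ w) n
      ≈⟨ ⋆-scaleˡ q (τ ^_) w n ⟩
    q * ((τ ^_) ⋆ w) n
      ≈⟨ *-congˡ (⋆-scaleʳ q⁻¹ (τ ^_) (exponentials r₁ r₂) n) ⟩
    q * (q⁻¹ * ((τ ^_) ⋆ exponentials r₁ r₂) n)
      ≈⟨ *-assoc _ _ _ ⟨
    q * q⁻¹ * ((τ ^_) ⋆ exponentials r₁ r₂) n
      ≈⟨ *-cong qq⁻¹ (⋆-exponentials r₁ r₂ τ n) ⟩
    1# * exponentials (τ + r₁) (τ + r₂) n
      ≈⟨ *-identityˡ _ ⟩
    exponentials (τ + r₁) (τ + r₂) n
      ≈⟨ exponentials-cong (cancel τ σ) (cancel τ (- σ)) n ⟩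
    exponentials σ (- σ) n ∎
    where
    cancel : ∀ x y → x + (y - x) ≈ y
    cancel = solve 2 (λ x y → x :+ (y :- x) := y) refl

  denominator-egf : denominator ≋ egf (N ⋆ w)
  denominator-egf n = begin
    (const q ⊛ cosh σ) n - (const p ⊛ sinh σ) n
      ≈⟨ +-cong (const-⊛ q (cosh σ) n) (-‿cong (const-⊛ p (sinh σ) n)) ⟩
    q * cosh σ n - p * sinh σ n
      ≈⟨ +-cong (*-congˡ (const-⊛ h (exp σ ⊕ exp (- σ)) n)) (-‿cong (*-congˡ (const-⊛ h (exp σ ⊖ exp (- σ)) n))) ⟩
    q * (h * (1/! n * x + 1/! n * y)) - p * (h * (1/! n * x - 1/! n * y))
      -- Collecting the powers of `σ` and of `- σ` produces the coefficients `α` and `β`.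
      ≈⟨ solve 5 (λ e p q x y → q :* (con ½ :* (e :* x :+ e :* y)) :- p :* (con ½ :* (e :* x :- e :* y))
                   := e :* (con ½ :* (q :- p) :* x :+ con ½ :* (q :+ p) :* y)) refl (1/! n) p q x y ⟩
    1/! n * exponentials σ (- σ) n
      ≈⟨ *-congˡ (N⋆w n) ⟨
    1/! n * (N ⋆ w) n ∎
    where
    x = σ ^ n
    y = (- σ) ^ n

  N⋆N⁻¹ : ∀ n → (N ⋆ N⁻¹) n ≈ 0# ^ n
  N⋆N⁻¹ n = begin
    (N ⋆ N⁻¹) n
      ≈⟨ ⋆-scaleˡ q (τ ^_) N⁻¹ n ⟩
    q * ((τ ^_) ⋆ N⁻¹) n
      ≈⟨ *-congˡ (⋆-scaleʳ q⁻¹ (τ ^_) ((- τ) ^_) n) ⟩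
    q * (q⁻¹ * ((τ ^_) ⋆ ((- τ) ^_)) n)
      ≈⟨ *-assoc _ _ _ ⟨
    q * q⁻¹ * ((τ ^_) ⋆ ((- τ) ^_)) n
      ≈⟨ *-cong qq⁻¹ (⋆-power τ (- τ) n) ⟩
    1# * (τ - τ) ^ n
      ≈⟨ *-identityˡ _ ⟩
    (τ - τ) ^ n
      ≈⟨ ^-congˡ n (-‿inverseʳ τ) ⟩
    0# ^ n ∎

  N⋆D⁻¹ : ∀ n → (N ⋆ D⁻¹) n ≈ W n
  N⋆D⁻¹ n = begin
    (N ⋆ (W ⋆ N⁻¹)) n    ≈⟨ ⋆-assoc N W N⁻¹ n ⟨
    (N ⋆ W ⋆ N⁻¹) n      ≈⟨ ⋆-cong (⋆-comm N W) (λ _ → refl) n ⟩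
    (W ⋆ N ⋆ N⁻¹) n      ≈⟨ ⋆-assoc W N N⁻¹ n ⟩
    (W ⋆ (N ⋆ N⁻¹)) n    ≈⟨ ⋆-cong {W} (λ _ → refl) N⋆N⁻¹ n ⟩
    (W ⋆ (0# ^_)) n      ≈⟨ ⋆-identityʳ W n ⟩
    W n                  ∎

  D⋆D⁻¹ : ∀ n → (N ⋆ w ⋆ D⁻¹) n ≈ 0# ^ n
  D⋆D⁻¹ n = begin
    (N ⋆ w ⋆ D⁻¹) n      ≈⟨ ⋆-cong (⋆-comm N w) (λ _ → refl) n ⟩
    (w ⋆ N ⋆ D⁻¹) n      ≈⟨ ⋆-assoc w N D⁻¹ n ⟩
    (w ⋆ (N ⋆ D⁻¹)) n    ≈⟨ ⋆-cong {w} (λ _ → refl) N⋆D⁻¹ n ⟩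
    (w ⋆ W) n            ≈⟨ w⋆W n ⟩
    0# ^ n               ∎

  denominator-invertible : Invertible _≋_ 𝟙 _⊛_ denominator
  denominator-invertible = egf D⁻¹ , inverseˡ , inverseʳ
    where
    inverseʳ : denominator ⊛ egf D⁻¹ ≋ 𝟙
    inverseʳ n = begin
      (denominator ⊛ egf D⁻¹) n   ≈⟨ ⊛-congʳ (egf D⁻¹) denominator-egf n ⟩
      (egf (N ⋆ w) ⊛ egf D⁻¹) n   ≈⟨ egf-⊛ (N ⋆ w) D⁻¹ n ⟩
      egf (N ⋆ w ⋆ D⁻¹) n         ≈⟨ egf-cong D⋆D⁻¹ n ⟩
      egf (0# ^_) n               ≈⟨ egf-0^ n ⟩
      𝟙 n                         ∎

    inverseˡ : egf D⁻¹ ⊛ denominator ≋ 𝟙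
    inverseˡ n = begin
      (egf D⁻¹ ⊛ denominator) n   ≈⟨ ⊛-congˡ (egf D⁻¹) denominator-egf n ⟩
      (egf D⁻¹ ⊛ egf (N ⋆ w)) n   ≈⟨ egf-⊛ D⁻¹ (N ⋆ w) n ⟩
      egf (D⁻¹ ⋆ (N ⋆ w)) n       ≈⟨ egf-cong (λ k → trans (⋆-comm D⁻¹ (N ⋆ w) k) (D⋆D⁻¹ k)) n ⟩
      egf (0# ^_) n               ≈⟨ egf-0^ n ⟩
      𝟙 n                         ∎

  numerator⊛D⁻¹ : numerator ⊛ egf D⁻¹ ≋ egf W
  numerator⊛D⁻¹ n = begin
    (numerator ⊛ egf D⁻¹) n   ≈⟨ ⊛-congʳ (egf D⁻¹) numerator-egf n ⟩
    (egf N ⊛ egf D⁻¹) n       ≈⟨ egf-⊛ N D⁻¹ n ⟩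
    egf (N ⋆ D⁻¹) n           ≈⟨ egf-cong N⋆D⁻¹ n ⟩
    egf W n                   ∎

  -- The two identities

  first-identity : 𝟙 ⊕ egf≥1 (λ n → ∑ (𝔖-avoiding-123 n) (λ π → t ^ suc (des π))) ≋ numerator ⊛ egf D⁻¹
  first-identity n = trans (lhs n) (sym (numerator⊛D⁻¹ n))
    where
    lhs : 𝟙 ⊕ egf≥1 (λ n → ∑ (𝔖-avoiding-123 n) (λ π → t ^ suc (des π))) ≋ egf W
    -- The sum starts at n = 1; the constant term `𝟙` is matched by `W 0`, which is 1.
    lhs zero    = trans (+-identityʳ 1#) (sym (egf-0 W))
    lhs (suc n) = trans (+-identityˡ _) (*-congˡ (∑-𝔖-avoiding-123 n))

  -- The product is bracketed to the left, so the scalar enters the sequence of the numerator before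
  -- `egf-⊛` applies.
  const⊛numerator⊛D⁻¹ : ∀ a n → (const a ⊛ numerator ⊛ egf D⁻¹) n ≈ a * egf W n
  const⊛numerator⊛D⁻¹ a n = begin
    (const a ⊛ numerator ⊛ egf D⁻¹) n
      ≈⟨ ⊛-congʳ (egf D⁻¹) scaled n ⟩
    (egf (λ k → a * N k) ⊛ egf D⁻¹) n
      ≈⟨ egf-⊛ (λ k → a * N k) D⁻¹ n ⟩
    egf ((λ k → a * N k) ⋆ D⁻¹) n
      ≈⟨ egf-cong (λ k → trans (⋆-scaleˡ a N D⁻¹ k) (*-congˡ (N⋆D⁻¹ k))) n ⟩
    1/! n * (a * W n)
      ≈⟨ swap (1/! n) (W n) ⟩
    a * egf W n ∎
    where
    swap : ∀ x y → x * (a * y) ≈ a * (x * y)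
    swap x y = ℕ-solve 3 (λ a x y → x ⊗′ (a ⊗′ y) ⊜′ a ⊗′ (x ⊗′ y)) refl a x y

    scaled : const a ⊛ numerator ≋ egf (λ k → a * N k)
    scaled k = trans (const-⊛ a numerator k) (trans (*-congˡ (numerator-egf k)) (sym (swap (1/! k) (N k))))

  ∑-*ˡ : ∀ {A : Set} (xs : List A) a f → ∑ xs (λ x → a * f x) ≈ a * ∑ xs f
  ∑-*ˡ []       a f = sym (zeroʳ a)
  ∑-*ˡ (x ∷ xs) a f = trans (+-congˡ (∑-*ˡ xs a f)) (sym (distribˡ _ _ _))

  -- In positive degree this is the first identity divided by `t`. In degree 0 the left side is 1
  -- but the quotient is `t⁻¹`, which the summands `- t⁻¹` and 1 correct.
  second-identity : ∀ t⁻¹ → t⁻¹ * t ≈ 1# →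
    egf (λ n → ∑ (𝔖-avoiding-123 n) (λ π → t ^ des π)) ≋
      const t⁻¹ ⊛ numerator ⊛ egf D⁻¹ ⊖ const t⁻¹ ⊕ 𝟙
  second-identity t⁻¹ inv zero = begin
    egf P 0
      ≈⟨ trans (egf-0 P) (+-identityʳ 1#) ⟩
    1#
      ≈⟨ trans (+-congʳ (-‿inverseʳ t⁻¹)) (+-identityˡ 1#) ⟨
    t⁻¹ - t⁻¹ + 1#
      ≈⟨ +-congʳ (+-congʳ (trans (const⊛numerator⊛D⁻¹ t⁻¹ 0) (trans (*-congˡ (egf-0 W)) (*-identityʳ t⁻¹)))) ⟨
    (const t⁻¹ ⊛ numerator ⊛ egf D⁻¹ ⊖ const t⁻¹ ⊕ 𝟙) 0 ∎
    where
    P : ℕ → Carrier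
    P n = ∑ (𝔖-avoiding-123 n) (λ π → t ^ des π)
  second-identity t⁻¹ inv (suc n) = begin
    1/! m * P
      ≈⟨ *-congˡ divide ⟩
    1/! m * (t⁻¹ * W m)
      ≈⟨ ℕ-solve 3 (λ a x y → x ⊗′ (a ⊗′ y) ⊜′ a ⊗′ (x ⊗′ y)) refl t⁻¹ (1/! m) (W m) ⟩
    t⁻¹ * egf W m
      ≈⟨ const⊛numerator⊛D⁻¹ t⁻¹ m ⟨
    (const t⁻¹ ⊛ numerator ⊛ egf D⁻¹) m
      ≈⟨ trans (+-identityʳ _) (trans (+-congˡ -0#≈0#) (+-identityʳ _)) ⟨
    (const t⁻¹ ⊛ numerator ⊛ egf D⁻¹ ⊖ const t⁻¹ ⊕ 𝟙) m ∎
    where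
    m = suc n
    P = ∑ (𝔖-avoiding-123 m) (λ π → t ^ des π)

    divide : P ≈ t⁻¹ * W m
    divide = begin
      P               ≈⟨ *-identityˡ P ⟨
      1# * P          ≈⟨ *-congʳ inv ⟨
      t⁻¹ * t * P     ≈⟨ *-assoc _ _ _ ⟩
      t⁻¹ * (t * P)   ≈⟨ *-congˡ (∑-*ˡ (𝔖-avoiding-123 m) t (λ π → t ^ des π)) ⟨
      t⁻¹ * ∑ (𝔖-avoiding-123 m) (λ π → t ^ suc (des π))
                      ≈⟨ *-congˡ (∑-𝔖-avoiding-123 n) ⟩
      t⁻¹ * W m       ∎

theorem4p1 : ∀ {c ℓ₁ ℓ₂} (K : Extension c ℓ₁ ℓ₂) →
    let open Extension K
        open PowerSeries K
    in  Σ[ (t⁻¹ , _) ∈ Invertible _≈_ 1# _*_ t ]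
        Σ[ (denominator⁻¹ , _) ∈ Invertible _≋_ 𝟙 _⊛_ denominator ]
          (𝟙 ⊕ egf≥1 (λ n → ∑ (𝔖-avoiding-123 n) (λ π → t ^ suc (des π)))
             ≋ numerator ⊛ denominator⁻¹)
        × (egf (λ n → ∑ (𝔖-avoiding-123 n) (λ π → t ^ des π))
             ≋ const t⁻¹ ⊛ numerator ⊛ denominator⁻¹ ⊖ const t⁻¹ ⊕ 𝟙)
theorem4p1 K =
  t-invertible , denominator-invertible ,
  first-identity , second-identity (proj₁ t-invertible) (proj₁ (proj₂ t-invertible))
  where open ExtensionProperties K
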